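{- Let $t\ge2$, $\omega$ a primitive $t$-th root of unity, $n\ge1$, $X=(x_1,\dots,x_n)$, $\overline X=(1/x_1,\dots,1/x_n)$, $\widetilde X=(X,\overline X)$. Let $\mu\in\mathcal P_{tn}$ and $\lambda=(\pm\mu)_{2tn+1}$. Then \[ s_\lambda(\widetilde X,\omega\widetilde X,\dots,\omega^{t-1}\widetilde X,1)=\mathrm{sp}_\mu(X,\omega X,\dots,\omega^{t-1}X)\;\mathrm{oe}_\mu(X,\omega X,\dots,\omega^{t-1}X,1). \]
   Context: Partitions $\mu=(\mu_1\ge\mu_2\ge\dots\ge0)$, $\ell(\mu)$ = number of nonzero parts, $\mathcal P_m$ = partitions with $\ell\le m$. $h_k$ is the complete homogeneous symmetric polynomial ($h_0=1$, $h_k=0$ for $k<0$); for $\lambda\in\mathcal P_N$ and $N$ variables, $s_\lambda(Z)=\det(h_{\lambda_i-i+j}(Z))_{1\le i,j\le N}$. For $2\ell(\mu)\le N$, $(\pm\mu)_N$ denotes the partition $\mu_1+(\mu_1,\dots,\mu_{\ell(\mu)},0,\dots,0,-\mu_{\ell(\mu)},\dots,-\mu_1)$ of length $N$ ($\mu_1$ added to each entry, $N-2\ell(\mu)$ zeros). For $k$ variables $W=(w_1,\dots,w_k)$, $\overline W=(1/w_1,\dots,1/w_k)$ and $\lambda\in\mathcal P_k$: $\mathrm{sp}_\lambda(W)=\tfrac12\det(h_{\lambda_i-i+j}(W,\overline W)+h_{\lambda_i-i-j+2}(W,\overline W))_{1\le i,j\le k}$ and $\mathrm{oe}_\lambda(W)=\det(h_{\lambda_i-i+j}(W,\overline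 W)-h_{\lambda_i-i-j}(W,\overline W))_{1\le i,j\le k}$. $cX=(cx_1,\dots,cx_n)$. -}

module Defs where

open import Level using (Level; _⊔_)
open import Algebra.Bundles using (CommutativeRing)
open import Relation.Nullary using (¬_)
open import Data.Nat as ℕ using (ℕ; zero; suc; _<ᵇ_; _≡ᵇ_; _∸_)
open import Data.Integer as ℤ using (ℤ; +_; -[1+_])
open import Data.Fin as Fin using (Fin; toℕ; punchIn)
open import Data.Bool using (if_then_else_)
open import Data.List using (List; []; _∷_; _++_; map; concat; upTo)
open import Data.Product using (_×_)
open import Data.Vec using (Vec; lookup)


-- A field in the usual sense: a commutative ring with 1 ≠ 0 in which every
-- nonzero element is invertible.  The inverse is a total function whose value
-- at 0 is irrelevant (as in Lean/Mathlib); only x ≉ 0 ⇒ x * x⁻¹ ≈ 1 is assumed.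
record Field (c ℓ : Level) : Set (Level.suc (c ⊔ ℓ)) where
  field
    commutativeRing : CommutativeRing c ℓ
  open CommutativeRing commutativeRing public
  field
    _⁻¹       : Carrier → Carrier
    1≉0       : ¬ (1# ≈ 0#)
    inverseʳ  : ∀ x → ¬ (x ≈ 0#) → x * (x ⁻¹) ≈ 1#

module FieldDefs {c ℓ} (F : Field c ℓ) where
  open Field F

  pow : Carrier → ℕ → Carrier
  pow x zero    = 1#
  pow x (suc k) = x * pow x k

  IsPrimitiveRoot : ℕ → Carrier → Set ℓ
  IsPrimitiveRoot t ω = (pow ω t ≈ 1#) × (∀ k → 0 ℕ.< k → k ℕ.< t → ¬ (pow ω k ≈ 1#))


  hN : ℕ → List Carrier → Carrier
  hN zero    _       = 1#
  hN (suc k) []      = 0#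
  hN (suc k) (z ∷ Z) = z * hN k (z ∷ Z) + hN (suc k) Z

  h : ℤ → List Carrier → Carrier
  h (+ k)      Z = hN k Z
  h -[1+ _ ]   Z = 0#

  sumFin : ∀ {m} → (Fin m → Carrier) → Carrier
  sumFin {zero}  f = 0#
  sumFin {suc m} f = f Fin.zero + sumFin (λ i → f (Fin.suc i))

  det : ∀ {m} → (Fin m → Fin m → Carrier) → Carrier
  det {zero}  M = 1#
  det {suc m} M = sumFin (λ j → pow (- 1#) (toℕ j) * (M Fin.zero j *
                    det (λ r c' → M (Fin.suc r) (punchIn j c'))))

  ι : ∀ {m} → Fin m → ℤ
  ι i = + toℕ i

  schur : ∀ {N} → (Fin N → ℤ) → List Carrier → Carrier
  schur λ' Z = det (λ i j → h (λ' i ℤ.- ι i ℤ.+ ι j) Z)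

  withInv : List Carrier → List Carrier
  withInv W = W ++ map _⁻¹ W

  -- sp_λ(W) = ½ det(h_{λ_i-i+j}(W,W̄) + h_{λ_i-i-j+2}(W,W̄))  (1-indexed i,j;
  -- with 0-indexed i,j the second index is λ_i - i - j)
  sp : ∀ {k} → (Fin k → ℤ) → List Carrier → Carrier
  sp λ' W = ((1# + 1#) ⁻¹) * det (λ i j →
              h (λ' i ℤ.- ι i ℤ.+ ι j) (withInv W) +
              h (λ' i ℤ.- ι i ℤ.- ι j) (withInv W))

  -- oe_λ(W) = det(h_{λ_i-i+j}(W,W̄) - h_{λ_i-i-j}(W,W̄))  (1-indexed i,j;
  -- with 0-indexed i,j the second index is λ_i - i - j - 2)
  oe : ∀ {k} → (Fin k → ℤ) → List Carrier → Carrier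
  oe λ' W = det (λ i j →
              h (λ' i ℤ.- ι i ℤ.+ ι j) (withInv W) -
              h (λ' i ℤ.- ι i ℤ.- ι j ℤ.- + 2) (withInv W))

  rotations : ℕ → Carrier → List Carrier → List Carrier
  rotations t ω Y = concat (map (λ j → map (λ y → pow ω j * y) Y) (upTo t))

-- Partitions of length ≤ m, as weakly decreasing vectors of length m (padded by 0)
IsPartition : ∀ {m} → Vec ℕ m → Set
IsPartition {m} μ = ∀ (i j : Fin m) → i Fin.≤ j → lookup μ j ℕ.≤ lookup μ i

part : ∀ {m} → Vec ℕ m → ℕ → ℕ
part {zero}  μ k = 0
part {suc m} μ k = go μ k
  where
  go : ∀ {p} → Vec ℕ p → ℕ → ℕ
  go Data.Vec.[] _ = 0
  go (a Data.Vec.∷ as) zero = a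
  go (a Data.Vec.∷ as) (suc k) = go as k

asℤ : ∀ {m} → Vec ℕ m → (p : ℕ) → Fin p → ℤ
asℤ μ p i = + part μ (toℕ i)

pmPart : ∀ {m} → Vec ℕ m → Fin (2 ℕ.* m ℕ.+ 1) → ℤ
pmPart {m} μ i =
  let k = toℕ i ; μ₁ = + part μ 0 in
  if k <ᵇ m then μ₁ ℤ.+ + part μ k
  else if k ≡ᵇ m then μ₁
  else μ₁ ℤ.- + part μ ((2 ℕ.* m) ∸ k)

{-# OPTIONS --safe #-}
-- Let m = tn, N = 2m + 1, let Z be the alphabet of all ω^j x_i and H_k = h_k(Z, 1/Z, 1); up to
-- order this is the alphabet on the left-hand side.  Put P = (H_{μ_i-i+j}) and
-- Q = (H_{μ_i-i-j+1}) for 1 ≤ i, j ≤ m.  Differences of consecutive columns turn the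
-- determinants of sp and oe into det(P - Q) and det(P + Q), the factor 1/2 being absorbed by
-- the first column of sp.
-- Since the alphabet is closed under inversion, H_k + H_{-N-k} satisfies on all of ℤ a
-- recurrence of order N, whose companion matrix has determinant 1; it agrees with H_k for
-- k > -N.  Hence all row indices of the Jacobi-Trudi matrix may be lowered by μ_1 + m.
-- Afterwards the middle row is a unit vector and the rows i and N+1-i are mirror images, so
-- up to the order of rows and columns what remains is the block matrix (P Q; Q P), with
-- determinant det(P + Q) det(P - Q).  The sign of the reordering depends only on m, and
-- μ = ∅ shows that it is 1.
module Submission where

open import Defs
open import Relation.Nullary using (¬_; yes; no)
open import Data.Nat as ℕ using (ℕ; zero; suc; _<ᵇ_; _≡ᵇ_; _∸_)
open import Data.Vec using (Vec; []; _∷_; lookup; toList)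
open import Data.List as List using (List; _++_; _∷_; []; map; concat; length; upTo; applyUpTo; applyDownFrom)
open import Level using (_⊔_)
open import Algebra.Bundles using (CommutativeMonoid)
import Algebra.Properties.CommutativeSemigroup
import Algebra.Properties.Ring
import Algebra.Properties.Semiring.Mult.TCOptimised
import Algebra.Solver.Ring
open import Algebra.Solver.Ring.AlmostCommutativeRing using (fromCommutativeRing; _-Raw-AlmostCommutative⟶_)
open import Data.Bool using (true; false; if_then_else_; T)
open import Data.Empty using (⊥-elim)
open import Data.Fin as Fin using (Fin; zero; suc; toℕ; punchIn; splitAt; _↑ˡ_; _↑ʳ_; fromℕ<; inject₁)
import Data.Fin.Properties as Fin
open import Data.Integer as ℤ using (ℤ; +_; -[1+_])
import Data.Integer.Properties as ℤ
open import Data.Integer.Tactic.RingSolver using (solve-∀)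
import Data.List.Properties as List
import Data.List.Relation.Binary.Permutation.Propositional as ℕPerm
import Data.List.Relation.Binary.Permutation.Propositional.Properties as ℕPerm
import Data.List.Relation.Binary.Permutation.Setoid
import Data.List.Relation.Binary.Permutation.Setoid.Properties
open import Data.List.Relation.Binary.Pointwise using (Pointwise; []; _∷_)
open import Data.List.Relation.Unary.All using (All; []; _∷_)
import Data.List.Relation.Unary.All.Properties as All
open import Data.Maybe using (Maybe; just; nothing)
import Data.Nat.Properties as ℕ
open import Data.Product using (_×_; _,_; proj₁; proj₂; ∃)
open import Data.Sum as Sum using (_⊎_; inj₁; inj₂)
open import Data.Unit.Polymorphic using (⊤; tt)
open import Data.Vec.Functional using () renaming (_∷_ to infixr 5 _◂_)
import Data.Vec.Properties as Vec
open import Function using (_∘_; id)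
open import Relation.Binary.PropositionalEquality as ≡ using (_≡_)
import Relation.Binary.Reasoning.Setoid


-- The obstacle is the truncation of `H_k` to 0 for `k < 0`: the sequence solves its recurrence only
-- up to a unit impulse at `-N`, so the rows of the Jacobi-Trudi matrix cannot simply be moved
-- downwards. The characteristic polynomial is `S - 1` times factors `S² - (z + 1/z) S + 1`, hence
-- antipalindromic, and the mirrored sequence produces the opposite impulse; this is why the sum of
-- both is a solution. The sum is also invariant under `k ↦ -N - k`, and this invariance is what
-- pairs the rows. The shift by `μ_1 + m` gives the middle row the indices `-2m, ..., 0`, where the
-- extended sequence is `0, ..., 0, 1`. The three alphabets contain the letter 1 a different number
-- of times: never for `sp`, once for the Schur function, twice for `oe` (1 and its inverse). The
-- column differences rest on `h_k(Z) = h_k(1,Z) - h_{k-1}(1,Z)`, which adds the letter to `sp` and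
-- removes one copy from `oe`. Since `det` is given by expansion along the first row, its product
-- rule is first derived from a characterization by alternating forms.

module IntegerCoefficients {c ℓ} (F : Field c ℓ) where
  open Field F
  open Algebra.Properties.Ring ring
  open Algebra.Properties.Semiring.Mult.TCOptimised semiring
    using (1+×; ×-homo-+; ×1-homo-*) renaming (_×_ to _⋆_)
  open Relation.Binary.Reasoning.Setoid setoid

  -- The ring solver has to see when coefficients cancel, and `_≈_` comes with no decision
  -- procedure. Coefficients are therefore integers, whose equality is decidable.
  fromℤ : ℤ → Carrier
  fromℤ (+ n)    = n ⋆ 1#
  fromℤ -[1+ n ] = - (suc n ⋆ 1#)

  private
    cancel-1+ : ∀ x y → x - y ≈ (1# + x) - (1# + y)
    cancel-1+ x y = sym (begin
      (1# + x) - (1# + y)       ≈⟨ +-congˡ (sym (-‿+-comm 1# y)) ⟩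
      (1# + x) + (- 1# + - y)   ≈⟨ +-congʳ (+-comm 1# x) ⟩
      (x + 1#) + (- 1# + - y)   ≈⟨ +-assoc x 1# _ ⟩
      x + (1# + (- 1# + - y))   ≈⟨ +-congˡ (sym (+-assoc 1# _ _)) ⟩
      x + ((1# + - 1#) + - y)   ≈⟨ +-congˡ (+-congʳ (-‿inverseʳ 1#)) ⟩
      x + (0# + - y)            ≈⟨ +-congˡ (+-identityˡ _) ⟩
      x - y                     ∎)

    fromℤ-⊖ : ∀ m n → fromℤ (m ℤ.⊖ n) ≈ m ⋆ 1# - n ⋆ 1#
    fromℤ-⊖ m zero = begin
      m ⋆ 1#          ≈⟨ +-identityʳ _ ⟨
      m ⋆ 1# + 0#     ≈⟨ +-congˡ -0#≈0# ⟨
      m ⋆ 1# - 0#     ∎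
    fromℤ-⊖ zero (suc n) = sym (+-identityˡ _)
    fromℤ-⊖ (suc m) (suc n) = begin
      fromℤ (suc m ℤ.⊖ suc n)               ≡⟨ ≡.cong fromℤ (ℤ.[1+m]⊖[1+n]≡m⊖n m n) ⟩
      fromℤ (m ℤ.⊖ n)                       ≈⟨ fromℤ-⊖ m n ⟩
      m ⋆ 1# - n ⋆ 1#                       ≈⟨ cancel-1+ _ _ ⟩
      (1# + m ⋆ 1#) - (1# + n ⋆ 1#)         ≈⟨ +-cong (1+× m 1#) (-‿cong (1+× n 1#)) ⟨
      suc m ⋆ 1# - suc n ⋆ 1#               ∎

    fromℤ-neg : ∀ n → fromℤ (ℤ.- (+ n)) ≈ - (n ⋆ 1#)
    fromℤ-neg zero    = sym -0#≈0#
    fromℤ-neg (suc n) = refl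

    fromℤ-+ : ∀ i j → fromℤ (i ℤ.+ j) ≈ fromℤ i + fromℤ j
    fromℤ-+ (+ m)    (+ n)    = ×-homo-+ 1# m n
    fromℤ-+ (+ m)    -[1+ n ] = fromℤ-⊖ m (suc n)
    fromℤ-+ -[1+ m ] (+ n)    = trans (fromℤ-⊖ n (suc m)) (+-comm _ _)
    fromℤ-+ -[1+ m ] -[1+ n ] = begin
      - (suc (suc (m ℕ.+ n)) ⋆ 1#)          ≡⟨ ≡.cong (λ k → - (suc k ⋆ 1#)) (≡.sym (ℕ.+-suc m n)) ⟩
      - ((suc m ℕ.+ suc n) ⋆ 1#)            ≈⟨ -‿cong (×-homo-+ 1# (suc m) (suc n)) ⟩
      - (suc m ⋆ 1# + suc n ⋆ 1#)           ≈⟨ -‿+-comm _ _ ⟨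
      - (suc m ⋆ 1#) - suc n ⋆ 1#           ∎

    fromℤ-* : ∀ i j → fromℤ (i ℤ.* j) ≈ fromℤ i * fromℤ j
    fromℤ-* (+ m) (+ n) = begin
      fromℤ (+ m ℤ.* + n)       ≡⟨ ≡.cong fromℤ (≡.sym (ℤ.pos-* m n)) ⟩
      (m ℕ.* n) ⋆ 1#            ≈⟨ ×1-homo-* m n ⟩
      m ⋆ 1# * n ⋆ 1#           ∎
    fromℤ-* (+ m) -[1+ n ] = begin
      fromℤ (+ m ℤ.* -[1+ n ])          ≡⟨ ≡.cong fromℤ (≡.trans (≡.sym (ℤ.neg-distribʳ-* (+ m) (+ suc n))) (≡.cong ℤ.-_ (≡.sym (ℤ.pos-* m (suc n))))) ⟩
      fromℤ (ℤ.- (+ (m ℕ.* suc n)))     ≈⟨ fromℤ-neg (m ℕ.* suc n) ⟩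
      - ((m ℕ.* suc n) ⋆ 1#)            ≈⟨ -‿cong (×1-homo-* m (suc n)) ⟩
      - (m ⋆ 1# * suc n ⋆ 1#)           ≈⟨ -‿distribʳ-* _ _ ⟩
      m ⋆ 1# * - (suc n ⋆ 1#)           ∎
    fromℤ-* -[1+ m ] (+ n) = begin
      fromℤ (-[1+ m ] ℤ.* + n)          ≡⟨ ≡.cong fromℤ (≡.trans (≡.sym (ℤ.neg-distribˡ-* (+ suc m) (+ n))) (≡.cong ℤ.-_ (≡.sym (ℤ.pos-* (suc m) n)))) ⟩
      fromℤ (ℤ.- (+ (suc m ℕ.* n)))     ≈⟨ fromℤ-neg (suc m ℕ.* n) ⟩
      - ((suc m ℕ.* n) ⋆ 1#)            ≈⟨ -‿cong (×1-homo-* (suc m) n) ⟩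
      - (suc m ⋆ 1# * n ⋆ 1#)           ≈⟨ -‿distribˡ-* _ _ ⟩
      - (suc m ⋆ 1#) * n ⋆ 1#           ∎
    fromℤ-* -[1+ m ] -[1+ n ] = begin
      (suc m ℕ.* suc n) ⋆ 1#            ≈⟨ ×1-homo-* (suc m) (suc n) ⟩
      suc m ⋆ 1# * suc n ⋆ 1#           ≈⟨ -‿involutive _ ⟨
      - - (suc m ⋆ 1# * suc n ⋆ 1#)     ≈⟨ -‿cong (-‿distribˡ-* _ _) ⟩
      - (- (suc m ⋆ 1#) * suc n ⋆ 1#)   ≈⟨ -‿distribʳ-* _ _ ⟩
      - (suc m ⋆ 1#) * - (suc n ⋆ 1#)   ∎

    fromℤ-- : ∀ i → fromℤ (ℤ.- i) ≈ - fromℤ i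
    fromℤ-- (+ n)    = fromℤ-neg n
    fromℤ-- -[1+ n ] = sym (-‿involutive _)

    morphism : ℤ.+-*-rawRing -Raw-AlmostCommutative⟶ fromCommutativeRing commutativeRing
    morphism = record
      { ⟦_⟧ = fromℤ ; +-homo = fromℤ-+ ; *-homo = fromℤ-* ; -‿homo = fromℤ--
      ; 0-homo = refl ; 1-homo = refl }

    fromℤ-≟ : ∀ i j → Maybe (fromℤ i ≈ fromℤ j)
    fromℤ-≟ i j with i ℤ.≟ j
    ... | yes i≡j = just (reflexive (≡.cong fromℤ i≡j))
    ... | no  _   = nothing

  open Algebra.Solver.Ring ℤ.+-*-rawRing (fromCommutativeRing commutativeRing) morphism fromℤ-≟ public
    using (solve; _:=_; _:+_; _:*_; _:-_; :-_; con)

-- Finite sums and Laplace expansion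

module Determinants {c ℓ} (F : Field c ℓ) where
  open Field F hiding (zero)
  open FieldDefs F
  open IntegerCoefficients F
  open Algebra.Properties.Ring ring
  open Relation.Binary.Reasoning.Setoid setoid

  sgn : ∀ {n} → Fin n → Carrier
  sgn i = pow (- 1#) (toℕ i)

  sum-cong : ∀ {n} {f g : Fin n → Carrier} → (∀ i → f i ≈ g i) → sumFin f ≈ sumFin g
  sum-cong {zero}  f≈g = refl
  sum-cong {suc n} f≈g = +-cong (f≈g zero) (sum-cong (f≈g ∘ suc))

  sum-zero : ∀ {n} {f : Fin n → Carrier} → (∀ i → f i ≈ 0#) → sumFin f ≈ 0#
  sum-zero {zero}  f≈0 = refl
  sum-zero {suc n} f≈0 = trans (+-cong (f≈0 zero) (sum-zero (f≈0 ∘ suc))) (+-identityˡ 0#)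

  sum-+ : ∀ {n} (f g : Fin n → Carrier) → sumFin (λ i → f i + g i) ≈ sumFin f + sumFin g
  sum-+ {zero}  f g = sym (+-identityˡ 0#)
  sum-+ {suc n} f g = trans (+-congˡ (sum-+ (f ∘ suc) (g ∘ suc)))
    (solve 4 (λ a b x y → (a :+ b) :+ (x :+ y) := (a :+ x) :+ (b :+ y)) refl _ _ _ _)

  sum-*ˡ : ∀ {n} a (f : Fin n → Carrier) → sumFin (λ i → a * f i) ≈ a * sumFin f
  sum-*ˡ {zero}  a f = sym (zeroʳ a)
  sum-*ˡ {suc n} a f = trans (+-congˡ (sum-*ˡ a (f ∘ suc))) (sym (distribˡ a _ _))

  sum-swap : ∀ {m n} (f : Fin m → Fin n → Carrier) →
             sumFin (λ i → sumFin (f i)) ≈ sumFin (λ j → sumFin (λ i → f i j))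
  sum-swap {zero}  {n} f = sym (sum-zero {n} (λ _ → refl))
  sum-swap {suc m} f = trans (+-congˡ (sum-swap (f ∘ suc))) (sym (sum-+ (f zero) _))

  sum-++ : ∀ m {n} (f : Fin (m ℕ.+ n) → Carrier) →
           sumFin f ≈ sumFin (λ i → f (i ↑ˡ n)) + sumFin (λ j → f (m ↑ʳ j))
  sum-++ zero    f = sym (+-identityˡ _)
  sum-++ (suc m) f = trans (+-congˡ (sum-++ m (f ∘ suc))) (sym (+-assoc _ _ _))

  sum-punchIn : ∀ {n} (k : Fin (suc n)) (f : Fin (suc n) → Carrier) →
                sumFin f ≈ f k + sumFin (f ∘ punchIn k)
  sum-punchIn zero f = refl
  sum-punchIn {suc n} (suc k) f = trans (+-congˡ (sum-punchIn k (f ∘ suc)))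
    (solve 3 (λ a b x → a :+ (b :+ x) := b :+ (a :+ x)) refl _ _ _)

  δ : ∀ {n} → Fin n → Fin n → Carrier
  δ zero    zero    = 1#
  δ zero    (suc j) = 0#
  δ (suc i) zero    = 0#
  δ (suc i) (suc j) = δ i j

  sum-δ : ∀ {n} (i : Fin n) (f : Fin n → Carrier) → sumFin (λ k → δ i k * f k) ≈ f i
  sum-δ {suc n} zero f = trans (+-cong (*-identityˡ _) (sum-zero {n} (λ k → zeroˡ _))) (+-identityʳ _)
  sum-δ (suc i) f = trans (+-cong (zeroˡ _) (sum-δ i (f ∘ suc))) (+-identityˡ _)

  δ-sym : ∀ {n} (i j : Fin n) → δ i j ≡ δ j i
  δ-sym zero    zero    = ≡.refl
  δ-sym zero    (suc j) = ≡.refl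
  δ-sym (suc i) zero    = ≡.refl
  δ-sym (suc i) (suc j) = δ-sym i j

  δ-refl : ∀ {n} (i : Fin n) → δ i i ≡ 1#
  δ-refl zero    = ≡.refl
  δ-refl (suc i) = δ-refl i

  δ-< : ∀ {n} {i j : Fin n} → i Fin.< j → δ i j ≡ 0#
  δ-< {i = zero}  {suc j} _ = ≡.refl
  δ-< {i = suc i} {suc j} (ℕ.s≤s i<j) = δ-< i<j

  Matrix : ℕ → Set c
  Matrix n = Fin n → Fin n → Carrier

  det-cong : ∀ {n} {A B : Matrix n} → (∀ i j → A i j ≈ B i j) → det A ≈ det B
  det-cong {zero}  A≈B = refl
  det-cong {suc n} A≈B = sum-cong λ j →
    *-congˡ {sgn j} (*-cong (A≈B zero j) (det-cong λ r c → A≈B (suc r) (punchIn j c)))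

  -- The corner term is common to both expansions. Each other minor of the first row is expanded
  -- along its first column by induction; the resulting double sum runs over minors without row 0
  -- and column 0, and summing over columns first gives row expansions of the minors of the first
  -- column.
  det-column : ∀ {n} (M : Matrix (suc n)) →
    det M ≈ sumFin (λ i → sgn i * (M i zero * det (λ r c → M (punchIn i r) (suc c))))
  det-column {zero}  M = refl
  det-column {suc n} M = +-congˡ (begin
    sumFin (λ j → sgn (suc j) * (M zero (suc j) * det (λ r c → M (suc r) (punchIn (suc j) c))))
      ≈⟨ sum-cong {suc n} (λ j → trans
           (*-congˡ {sgn (suc j)} (*-congˡ {M zero (suc j)} (det-column (λ r c → M (suc r) (punchIn (suc j) c)))))
           (push {suc n} (sgn (suc j)) (M zero (suc j)) (λ i → sgn i * (M (suc i) zero * minor i j)))) ⟩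
    sumFin (λ j → sumFin (λ i → sgn (suc j) * (M zero (suc j) * (sgn i * (M (suc i) zero * minor i j)))))
      ≈⟨ sum-swap {suc n} {suc n}
           (λ j i → sgn (suc j) * (M zero (suc j) * (sgn i * (M (suc i) zero * minor i j)))) ⟩
    sumFin (λ i → sumFin (λ j → sgn (suc j) * (M zero (suc j) * (sgn i * (M (suc i) zero * minor i j)))))
      ≈⟨ sum-cong {suc n} (λ i → sum-cong {suc n} (λ j → solve 6
           (λ e s a s′ b d → (e :* s) :* (a :* (s′ :* (b :* d))) := (e :* s′) :* (b :* (s :* (a :* d))))
           refl (- 1#) (sgn j) (M zero (suc j)) (sgn i) (M (suc i) zero) (minor i j))) ⟩
    sumFin (λ i → sumFin (λ j → sgn (suc i) * (M (suc i) zero * (sgn j * (M zero (suc j) * minor i j)))))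
      ≈⟨ sum-cong {suc n} (λ i → push {suc n} (sgn (suc i)) (M (suc i) zero)
           (λ j → sgn j * (M zero (suc j) * minor i j))) ⟨
    sumFin (λ i → sgn (suc i) * (M (suc i) zero * det (λ r c → M (punchIn (suc i) r) (suc c)))) ∎)
    where
    minor : Fin (suc n) → Fin (suc n) → Carrier
    minor i j = det (λ r c → M (suc (punchIn i r)) (suc (punchIn j c)))
    push : ∀ {k} s a (f : Fin k → Carrier) → s * (a * sumFin f) ≈ sumFin (λ i → s * (a * f i))
    push s a f = sym (trans (sum-*ˡ s (λ i → a * f i)) (*-congˡ (sum-*ˡ a f)))

  det-transpose : ∀ {n} (M : Matrix n) → det (λ i j → M j i) ≈ det M
  det-transpose {zero}  M = refl
  det-transpose {suc n} M = sym (trans (det-column M)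
    (sum-cong λ i → *-congˡ {sgn i} (*-congˡ {M i zero} (sym (det-transpose (λ r c → M (punchIn i r) (suc c)))))))

  det-unitriangular : ∀ {n} (M : Matrix n) → (∀ i → M i i ≈ 1#) →
                      (∀ i j → j Fin.< i → M i j ≈ 0#) → det M ≈ 1#
  det-unitriangular {zero}  M diag below = refl
  det-unitriangular {suc n} M diag below = begin
    det M
      ≈⟨ det-column M ⟩
    1# * (M zero zero * det (λ r c → M (suc r) (suc c))) + sumFin (λ i → sgn (suc i) * (M (suc i) zero * _))
      ≈⟨ +-cong (*-congˡ (*-cong (diag zero) (det-unitriangular _ (diag ∘ suc) (λ i j j<i → below _ _ (ℕ.s≤s j<i)))))
                (sum-zero (λ i → trans (*-congˡ (trans (*-congʳ (below (suc i) zero (ℕ.s≤s ℕ.z≤n))) (zeroˡ _))) (zeroʳ _))) ⟩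
    1# * (1# * 1#) + 0#
      ≈⟨ trans (+-identityʳ _) (trans (*-identityˡ _) (*-identityˡ _)) ⟩
    1# ∎

  -- Alternating multilinear forms and the product rule for determinants

  Form : ℕ → ℕ → Set c
  Form n k = (Fin n → Fin k → Carrier) → Carrier

  Adjacent : ∀ n {k} → Form (suc n) k → Set (c ⊔ ℓ)
  Adjacent zero    Φ = ⊤
  Adjacent (suc n) Φ = ∀ b w → Φ (b ◂ b ◂ w) ≈ 0#

  Congruent : ∀ {n k} → Form n k → Set (c ⊔ ℓ)
  Congruent Φ = ∀ {u v} → (∀ i j → u i j ≈ v i j) → Φ u ≈ Φ v

  LinearInFirst : ∀ {n k} → Form (suc n) k → Set (c ⊔ ℓ)
  LinearInFirst Φ = ∀ a u v w → Φ ((λ j → a * u j + v j) ◂ w) ≈ a * Φ (u ◂ w) + Φ (v ◂ w)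

  -- Only neighbouring equal arguments are required to give 0; linearity yields the rest.
  Alternating : ∀ n {k} → Form n k → Set (c ⊔ ℓ)
  Alternating zero    Φ = Congruent Φ
  Alternating (suc n) Φ =
    Congruent Φ × LinearInFirst Φ × Adjacent n Φ × (∀ b → Alternating n (λ w → Φ (b ◂ w)))

  ◂-cong : ∀ {n k} {b b′ : Fin k → Carrier} {w w′ : Fin n → Fin k → Carrier} →
           (∀ j → b j ≈ b′ j) → (∀ i j → w i j ≈ w′ i j) → ∀ i j → (b ◂ w) i j ≈ (b′ ◂ w′) i j
  ◂-cong b≈ w≈ zero    = b≈
  ◂-cong b≈ w≈ (suc i) = w≈ i

  ◂-η : ∀ {n k} (w : Fin (suc n) → Fin k → Carrier) → ∀ i j → (w zero ◂ (w ∘ suc)) i j ≈ w i j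
  ◂-η w zero    j = refl
  ◂-η w (suc i) j = refl

  -- Rows are functions, and `◂` commutes with column operations only pointwise. This lemma carries
  -- the property across such rewritings.
  alt-resp : ∀ n {k} {Φ Ψ : Form n k} → (∀ w → Φ w ≈ Ψ w) → Alternating n Φ → Alternating n Ψ
  alt-resp zero    Φ≈Ψ cong u≈v = trans (sym (Φ≈Ψ _)) (trans (cong u≈v) (Φ≈Ψ _))
  alt-resp (suc n) Φ≈Ψ (cong , linear , adj , tail) =
    (λ u≈v → trans (sym (Φ≈Ψ _)) (trans (cong u≈v) (Φ≈Ψ _))) ,
    (λ a u v w → trans (sym (Φ≈Ψ _)) (trans (linear a u v w) (+-cong (*-congˡ (Φ≈Ψ _)) (Φ≈Ψ _)))) ,
    adjacent n Φ≈Ψ adj ,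
    (λ b → alt-resp n (λ w → Φ≈Ψ (b ◂ w)) (tail b))
    where
    adjacent : ∀ n {k} {Φ Ψ : Form (suc n) k} → (∀ w → Φ w ≈ Ψ w) → Adjacent n Φ → Adjacent n Ψ
    adjacent zero    _   _   = tt
    adjacent (suc n) Φ≈Ψ adj b w = trans (sym (Φ≈Ψ _)) (adj b w)

  alt-scale : ∀ n {k} {Φ : Form n k} a → Alternating n Φ → Alternating n (λ w → a * Φ w)
  alt-scale zero    a cong u≈v = *-congˡ (cong u≈v)
  alt-scale (suc n) a (cong , linear , adj , tail) =
    (λ u≈v → *-congˡ (cong u≈v)) ,
    (λ x u v w → trans (*-congˡ (linear x u v w))
      (solve 4 (λ a x p q → a :* (x :* p :+ q) := x :* (a :* p) :+ a :* q) refl _ _ _ _)) ,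
    adjacent n adj ,
    (λ b → alt-scale n a (tail b))
    where
    adjacent : ∀ n {k} {Φ : Form (suc n) k} → Adjacent n Φ → Adjacent n (λ w → a * Φ w)
    adjacent zero    _   = tt
    adjacent (suc n) adj b w = trans (*-congˡ (adj b w)) (zeroʳ a)

  alt-sum : ∀ n {k m} {Φ : Fin m → Form n k} → (∀ j → Alternating n (Φ j)) →
            Alternating n (λ w → sumFin (λ j → Φ j w))
  alt-sum zero    alt u≈v = sum-cong (λ j → alt j u≈v)
  alt-sum (suc n) {m = m} {Φ} alt =
    (λ u≈v → sum-cong (λ j → proj₁ (alt j) u≈v)) ,
    (λ a u v w → begin
      sumFin (λ j → Φ j ((λ j → a * u j + v j) ◂ w))
        ≈⟨ sum-cong (λ j → proj₁ (proj₂ (alt j)) a u v w) ⟩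
      sumFin (λ j → a * Φ j (u ◂ w) + Φ j (v ◂ w))
        ≈⟨ sum-+ (λ j → a * Φ j (u ◂ w)) (λ j → Φ j (v ◂ w)) ⟩
      sumFin (λ j → a * Φ j (u ◂ w)) + sumFin (λ j → Φ j (v ◂ w))
        ≈⟨ +-congʳ (sum-*ˡ a (λ j → Φ j (u ◂ w))) ⟩
      a * sumFin (λ j → Φ j (u ◂ w)) + sumFin (λ j → Φ j (v ◂ w)) ∎) ,
    adjacent n (λ j → proj₁ (proj₂ (proj₂ (alt j)))) ,
    (λ b → alt-sum n (λ j → proj₂ (proj₂ (proj₂ (alt j))) b))
    where
    adjacent : ∀ n {k} {Φ : Fin m → Form (suc n) k} → (∀ j → Adjacent n (Φ j)) →
               Adjacent n (λ w → sumFin (λ j → Φ j w))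
    adjacent zero    _   = tt
    adjacent (suc n) adj b w = sum-zero (λ j → adj j b w)

  -- With `φ = punchIn j` this makes a minor an alternating form of the rows of the whole matrix. It
  -- is the reason for keeping the width of the rows apart from their number.
  alt-columns : ∀ n {k k′} {Φ : Form n k} (φ : Fin k → Fin k′) → Alternating n Φ →
                Alternating n (λ w → Φ (λ r → w r ∘ φ))
  alt-columns zero    φ cong u≈v = cong (λ i j → u≈v i (φ j))
  alt-columns (suc n) {k} {k′} {Φ} φ (cong , linear , adj , tail) =
    (λ u≈v → cong (λ i j → u≈v i (φ j))) ,
    (λ a u v w → trans (cong (split _ w)) (trans (linear a (u ∘ φ) (v ∘ φ) (λ r → w r ∘ φ))
       (+-cong (*-congˡ (sym (cong (split u w)))) (sym (cong (split v w)))))) ,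
    adjacent n cong adj ,
    (λ b → alt-resp n (λ w → sym (cong (split b w))) (alt-columns n φ (tail (b ∘ φ))))
    where
    split : ∀ {n} (b : Fin k′ → Carrier) (w : Fin n → Fin k′ → Carrier) i j →
            (b ◂ w) i (φ j) ≈ ((b ∘ φ) ◂ (λ r → w r ∘ φ)) i j
    split b w zero    j = refl
    split b w (suc i) j = refl
    adjacent : ∀ n {Φ : Form (suc n) k} → Congruent Φ → Adjacent n Φ → Adjacent n (λ w → Φ (λ r → w r ∘ φ))
    adjacent zero    _    _   = tt
    adjacent (suc n) cong adj b w = trans (cong (split² )) (adj (b ∘ φ) (λ r → w r ∘ φ))
      where
      split² : ∀ i j → (b ◂ b ◂ w) i (φ j) ≈ ((b ∘ φ) ◂ (b ∘ φ) ◂ (λ r → w r ∘ φ)) i j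
      split² zero          j = refl
      split² (suc zero)    j = refl
      split² (suc (suc i)) j = refl

  -- Polarization: `Φ` vanishes at `u + v` repeated, and expanding both slots leaves only the two
  -- mixed terms.
  alt-swap : ∀ n {k} {Φ : Form (suc (suc n)) k} → Alternating (suc (suc n)) Φ →
             ∀ u v w → Φ (u ◂ v ◂ w) ≈ - Φ (v ◂ u ◂ w)
  alt-swap n {k} {Φ} (cong , linear , adj , tail) u v w = begin
    Φ (u ◂ v ◂ w)
      ≈⟨ solve 4 (λ p q x y → x := (p :+ x) :+ (y :+ q) :- p :- q :- y) refl
           (Φ (u ◂ u ◂ w)) (Φ (v ◂ v ◂ w)) (Φ (u ◂ v ◂ w)) (Φ (v ◂ u ◂ w)) ⟩
    (Φ (u ◂ u ◂ w) + Φ (u ◂ v ◂ w)) + (Φ (v ◂ u ◂ w) + Φ (v ◂ v ◂ w)) - Φ (u ◂ u ◂ w) - Φ (v ◂ v ◂ w) - Φ (v ◂ u ◂ w)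
      ≈⟨ +-congʳ (+-cong (+-cong expand (-‿cong (adj u w))) (-‿cong (adj v w))) ⟩
    0# - 0# - 0# - Φ (v ◂ u ◂ w)
      ≈⟨ solve 1 (λ y → con (+ 0) :- con (+ 0) :- con (+ 0) :- y := :- y) refl _ ⟩
    - Φ (v ◂ u ◂ w) ∎
    where
    u+v : Fin k → Carrier
    -- The factor `1#` gives the sum the shape `a * u j + v j` in which linearity is available.
    u+v j = 1# * u j + v j
    second : ∀ b → Φ (b ◂ u+v ◂ w) ≈ Φ (b ◂ u ◂ w) + Φ (b ◂ v ◂ w)
    second b = trans (proj₁ (proj₂ (tail b)) 1# u v w) (+-congʳ (*-identityˡ _))
    expand : (Φ (u ◂ u ◂ w) + Φ (u ◂ v ◂ w)) + (Φ (v ◂ u ◂ w) + Φ (v ◂ v ◂ w)) ≈ 0#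
    expand = begin
      (Φ (u ◂ u ◂ w) + Φ (u ◂ v ◂ w)) + (Φ (v ◂ u ◂ w) + Φ (v ◂ v ◂ w)) ≈⟨ +-cong (second u) (second v) ⟨
      Φ (u ◂ u+v ◂ w) + Φ (v ◂ u+v ◂ w)        ≈⟨ +-congʳ (*-identityˡ _) ⟨
      1# * Φ (u ◂ u+v ◂ w) + Φ (v ◂ u+v ◂ w)   ≈⟨ linear 1# u v (u+v ◂ w) ⟨
      Φ (u+v ◂ u+v ◂ w)                        ≈⟨ adj u+v w ⟩
      0#                                       ∎

  alt-sum-first : ∀ n {k m} {Φ : Form (suc n) k} → Alternating (suc n) Φ →
    ∀ (a : Fin m → Carrier) (b : Fin m → Fin k → Carrier) w →
    Φ ((λ j → sumFin (λ l → a l * b l j)) ◂ w) ≈ sumFin (λ l → a l * Φ (b l ◂ w))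
  alt-sum-first n {m = zero} {Φ} (cong , linear , _) a b w = begin
    Φ ((λ _ → 0#) ◂ w)
      -- Linearity has no separate clause for the zero vector; writing it as (-1)·0 + 0 gives Φ(0) =
      -- -Φ(0) + Φ(0) = 0.
      ≈⟨ cong (◂-cong (λ _ → solve 0 (con (+ 0) := con -[1+ 0 ] :* con (+ 0) :+ con (+ 0)) refl) (λ _ _ → refl)) ⟩
    Φ ((λ _ → - 1# * 0# + 0#) ◂ w)
      ≈⟨ linear (- 1#) (λ _ → 0#) (λ _ → 0#) w ⟩
    - 1# * Φ ((λ _ → 0#) ◂ w) + Φ ((λ _ → 0#) ◂ w)
      ≈⟨ solve 1 (λ x → con -[1+ 0 ] :* x :+ x := con (+ 0)) refl _ ⟩
    0# ∎
  alt-sum-first n {m = suc m} alt@(cong , linear , _) a b w =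
    trans (linear (a zero) (b zero) _ w) (+-congˡ (alt-sum-first n alt (a ∘ suc) (b ∘ suc) w))

  -- Adding multiples of `b` to the other rows changes nothing. The second row is cleared by
  -- linearity and adjacency; a swap then brings `b` next to the remaining rows, so that the
  -- induction hypothesis applies to the form with the cleared row fixed.
  alt-reduce : ∀ n {k} {Φ : Form (suc n) k} → Alternating (suc n) Φ → ∀ b (a : Fin n → Carrier) w →
               Φ (b ◂ (λ i j → a i * b j + w i j)) ≈ Φ (b ◂ w)
  alt-reduce zero    (cong , _) b a w = cong (◂-cong (λ _ → refl) λ ())
  alt-reduce (suc n) {k} {Φ} alt@(cong , linear , adj , tail) b a w = begin
    Φ (b ◂ (λ i j → a i * b j + w i j))
      ≈⟨ cong (◂-cong (λ _ → refl) (λ i j → sym (◂-η (λ i j → a i * b j + w i j) i j))) ⟩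
    Φ (b ◂ (λ j → a zero * b j + w zero j) ◂ rest)
      ≈⟨ proj₁ (proj₂ (tail b)) (a zero) b (w zero) rest ⟩
    a zero * Φ (b ◂ b ◂ rest) + Φ (b ◂ w zero ◂ rest)
      ≈⟨ +-congʳ (trans (*-congˡ (adj b rest)) (zeroʳ _)) ⟩
    0# + Φ (b ◂ w zero ◂ rest)
      ≈⟨ +-identityˡ _ ⟩
    Φ (b ◂ w zero ◂ rest)
      ≈⟨ alt-swap n alt b (w zero) rest ⟩
    - Φ (w zero ◂ b ◂ rest)
      ≈⟨ -‿cong (alt-reduce n (tail (w zero)) b (a ∘ suc) (w ∘ suc)) ⟩
    - Φ (w zero ◂ b ◂ (w ∘ suc))
      ≈⟨ alt-swap n alt b (w zero) (w ∘ suc) ⟨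
    Φ (b ◂ w zero ◂ (w ∘ suc))
      ≈⟨ cong (◂-cong (λ _ → refl) (◂-η w)) ⟩
    Φ (b ◂ w) ∎
    where
    rest : Fin n → Fin k → Carrier
    rest i j = a (suc i) * b j + w (suc i) j

  -- Bringing row `l` to the front takes `l` exchanges of neighbours, each contributing a sign.
  alt-move : ∀ n {k} {Φ : Form (suc n) k} → Alternating (suc n) Φ → ∀ (b : Fin (suc n) → Fin k → Carrier) l →
             Φ (b l ◂ (b ∘ punchIn l)) ≈ sgn l * Φ b
  alt-move n       (cong , _) b zero = trans (cong (◂-η b)) (sym (*-identityˡ _))
  alt-move (suc n) {Φ = Φ} alt@(cong , linear , adj , tail) b (suc l) = begin
    Φ (b (suc l) ◂ (b ∘ punchIn (suc l)))
      ≈⟨ cong (◂-cong (λ _ → refl) (λ i j → sym (◂-η (b ∘ punchIn (suc l)) i j))) ⟩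
    Φ (b (suc l) ◂ b zero ◂ (b ∘ suc ∘ punchIn l))
      ≈⟨ alt-swap n alt _ _ _ ⟩
    - Φ (b zero ◂ b (suc l) ◂ (b ∘ suc ∘ punchIn l))
      ≈⟨ -‿cong (alt-move n (tail (b zero)) (b ∘ suc) l) ⟩
    - (sgn l * Φ (b zero ◂ (b ∘ suc)))
      ≈⟨ -‿cong (*-congˡ (cong (◂-η b))) ⟩
    - (sgn l * Φ b)
      ≈⟨ solve 2 (λ s x → :- (s :* x) := (con -[1+ 0 ] :* s) :* x) refl _ _ ⟩
    sgn (suc l) * Φ b ∎

  -- Alternating forms are determined up to a scalar. Expanding the first row of the product selects
  -- a vector `b l`; its multiples can be removed from the other rows, whose coefficients then form
  -- the minor of `A` without column `l`. Induction evaluates that minor, and moving `b l` back to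
  -- its place supplies the Laplace sign.
  alt-det : ∀ n {k} {Φ : Form n k} → Alternating n Φ → ∀ (A : Matrix n) (b : Fin n → Fin k → Carrier) →
            Φ (λ i j → sumFin (λ l → A i l * b l j)) ≈ det A * Φ b
  alt-det zero    cong A b = trans (cong λ ()) (sym (*-identityˡ _))
  alt-det (suc n) {k} {Φ} alt@(cong , linear , adj , tail) A b = begin
    Φ rows
      ≈⟨ cong (λ i j → sym (◂-η rows i j)) ⟩
    Φ ((λ j → sumFin (λ l → A zero l * b l j)) ◂ (rows ∘ suc))
      ≈⟨ alt-sum-first n alt (A zero) b _ ⟩
    sumFin (λ l → A zero l * Φ (b l ◂ (rows ∘ suc)))
      ≈⟨ sum-cong (λ l → trans (*-congˡ {A zero l} (term l))
           (solve 4 (λ a d s x → a :* (d :* (s :* x)) := x :* (s :* (a :* d))) refl (A zero l) (minor l) (sgn l) (Φ b))) ⟩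
    sumFin (λ l → Φ b * (sgn l * (A zero l * minor l)))
      ≈⟨ trans (sum-*ˡ {suc n} (Φ b) (λ l → sgn l * (A zero l * minor l))) (*-comm _ _) ⟩
    det A * Φ b ∎
    where
    rows : Fin (suc n) → Fin k → Carrier
    rows i j = sumFin (λ l → A i l * b l j)
    minor : Fin (suc n) → Carrier
    minor l = det (λ r c → A (suc r) (punchIn l c))
    term : ∀ l → Φ (b l ◂ (rows ∘ suc)) ≈ minor l * (sgn l * Φ b)
    term l = begin
      Φ (b l ◂ (rows ∘ suc))
        ≈⟨ cong (◂-cong (λ _ → refl) (λ i j → sum-punchIn l (λ l → A (suc i) l * b l j))) ⟩
      Φ (b l ◂ (λ i j → A (suc i) l * b l j + sumFin (λ l′ → A (suc i) (punchIn l l′) * b (punchIn l l′) j)))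
        ≈⟨ alt-reduce n alt (b l) _ _ ⟩
      Φ (b l ◂ (λ i j → sumFin (λ l′ → A (suc i) (punchIn l l′) * b (punchIn l l′) j)))
        ≈⟨ alt-det n (tail (b l)) _ (b ∘ punchIn l) ⟩
      minor l * Φ (b l ◂ (b ∘ punchIn l))
        ≈⟨ *-congˡ (alt-move n alt b l) ⟩
      minor l * (sgn l * Φ b) ∎

  -- Along the first column the first two terms cancel, and every other minor still contains both
  -- equal rows at its top, so it vanishes by induction.
  det-adjacent : ∀ {n} (M : Matrix (suc (suc n))) → (∀ j → M zero j ≈ M (suc zero) j) → det M ≈ 0#
  det-adjacent {n} M M₀≈M₁ = begin
    det M
      ≈⟨ det-column M ⟩
    1# * (M zero zero * det M₁) + (- 1# * 1# * (M (suc zero) zero * det M₂) + rest)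
      ≈⟨ +-congˡ (+-cong (*-congˡ (*-cong (sym (M₀≈M₁ zero)) (det-cong M₂≈M₁))) (sum-zero (others n M M₀≈M₁))) ⟩
    1# * (M zero zero * det M₁) + (- 1# * 1# * (M zero zero * det M₁) + 0#)
      ≈⟨ solve 1 (λ x → con (+ 1) :* x :+ (con -[1+ 0 ] :* con (+ 1) :* x :+ con (+ 0)) := con (+ 0)) refl _ ⟩
    0# ∎
    where
    M₁ M₂ : Matrix (suc n)
    M₁ r c = M (suc r) (suc c)
    M₂ r c = M (punchIn (suc zero) r) (suc c)
    rest : Carrier
    rest = sumFin (λ i → sgn (suc (suc i)) * (M (suc (suc i)) zero * det (λ r c → M (punchIn (suc (suc i)) r) (suc c))))
    M₂≈M₁ : ∀ r c → M₂ r c ≈ M₁ r c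
    M₂≈M₁ zero    c = M₀≈M₁ (suc c)
    M₂≈M₁ (suc r) c = refl
    others : ∀ n (M : Matrix (suc (suc n))) → (∀ j → M zero j ≈ M (suc zero) j) → (i : Fin n) →
      sgn (suc (suc i)) * (M (suc (suc i)) zero * det (λ r c → M (punchIn (suc (suc i)) r) (suc c))) ≈ 0#
    others (suc n) M M₀≈M₁ i = trans
      (*-congˡ (trans (*-congˡ (det-adjacent (λ r c → M (punchIn (suc (suc i)) r) (suc c)) (M₀≈M₁ ∘ suc))) (zeroʳ _)))
      (zeroʳ _)

  -- Row expansion shows linearity in the first row and exhibits the rest as a combination of
  -- smaller determinants, which are alternating by induction. Only the equality of the first two
  -- rows calls for the column expansion.
  det-alternating : ∀ n → Alternating n (det {n})
  det-alternating zero    _ = refl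
  det-alternating (suc n) =
    det-cong ,
    (λ a u v w → trans
      (sum-cong λ j → solve 5 (λ s a u v d → s :* ((a :* u :+ v) :* d) := a :* (s :* (u :* d)) :+ s :* (v :* d))
        refl (sgn j) a (u j) (v j) (minor w j))
      (trans (sum-+ (λ j → a * (sgn j * (u j * minor w j))) (λ j → sgn j * (v j * minor w j)))
             (+-congʳ (sum-*ˡ a (λ j → sgn j * (u j * minor w j)))))) ,
    adjacent n ,
    (λ b → alt-sum n (λ j → alt-scale n (sgn j) (alt-scale n (b j) (alt-columns n (punchIn j) (det-alternating n)))))
    where
    minor : (Fin n → Fin (suc n) → Carrier) → Fin (suc n) → Carrier
    minor w j = det (λ r c → w r (punchIn j c))
    adjacent : ∀ n → Adjacent n (det {suc n})
    adjacent zero    = tt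
    adjacent (suc n) b w = det-adjacent (b ◂ b ◂ w) (λ _ → refl)

  det-* : ∀ {n} (A B : Matrix n) → det (λ i j → sumFin (λ k → A i k * B k j)) ≈ det A * det B
  det-* {n} = alt-det n (det-alternating n)

  -- Selecting rows or columns is multiplication by a 0-1 matrix. The determinants of these matrices
  -- stand in for the signs of permutations, so no sign has to be computed from a permutation.
  det-reindex : ∀ {n} (ρ γ : Fin n → Fin n) (M : Matrix n) →
    det (λ i j → M (ρ i) (γ j)) ≈ det (δ ∘ ρ) * (det (δ ∘ γ) * det M)
  det-reindex ρ γ M = begin
    det (λ i j → M (ρ i) (γ j))
      ≈⟨ det-cong (λ i j → sum-δ (ρ i) (λ k → M k (γ j))) ⟨
    det (λ i j → sumFin (λ k → δ (ρ i) k * M k (γ j)))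
      ≈⟨ det-* (δ ∘ ρ) (λ k j → M k (γ j)) ⟩
    det (δ ∘ ρ) * det (λ k j → M k (γ j))
      ≈⟨ *-congˡ (det-transpose (λ j k → M k (γ j))) ⟩
    det (δ ∘ ρ) * det (λ j k → M k (γ j))
      ≈⟨ *-congˡ (det-cong (λ j k → sum-δ (γ j) (λ l → M k l))) ⟨
    det (δ ∘ ρ) * det (λ j k → sumFin (λ l → δ (γ j) l * M k l))
      ≈⟨ *-congˡ (det-* (δ ∘ γ) (λ l k → M k l)) ⟩
    det (δ ∘ ρ) * (det (δ ∘ γ) * det (λ l k → M k l))
      ≈⟨ *-congˡ (*-congˡ (det-transpose M)) ⟩
    det (δ ∘ ρ) * (det (δ ∘ γ) * det M) ∎

  -- Block triangular determinants

  BlockMatrix : ℕ → ℕ → Set c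
  BlockMatrix m n = Fin m ⊎ Fin n → Fin m ⊎ Fin n → Carrier

  blocks : ∀ {m n} → BlockMatrix m n → Matrix (m ℕ.+ n)
  blocks {m} X i j = X (splitAt m i) (splitAt m j)

  splitAt-punchIn : ∀ m {n} (j : Fin (suc m)) (i : Fin (m ℕ.+ n)) →
    splitAt (suc m) (punchIn (j ↑ˡ n) i) ≡ Sum.map (punchIn j) id (splitAt m i)
  splitAt-punchIn m       zero    i       = ≡.refl
  splitAt-punchIn (suc m) (suc j) zero    = ≡.refl
  splitAt-punchIn (suc m) (suc j) (suc i) = ≡.trans
    (≡.cong (Sum.map suc id) (splitAt-punchIn m j i)) (fuse (splitAt m i))
    where
    fuse : ∀ s → Sum.map suc id (Sum.map (punchIn j) id s) ≡ Sum.map (punchIn (suc j)) id (Sum.map suc id s)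
    fuse (inj₁ _) = ≡.refl
    fuse (inj₂ _) = ≡.refl

  -- In the first row only columns of the left block contribute, and deleting one of them leaves a
  -- matrix of the same block shape with the same lower right block.
  det-lowerBlocks : ∀ m {n} (X : BlockMatrix m n) → (∀ i j → X (inj₁ i) (inj₂ j) ≈ 0#) →
    det (blocks X) ≈ det (λ i j → X (inj₁ i) (inj₁ j)) * det (λ i j → X (inj₂ i) (inj₂ j))
  det-lowerBlocks zero    X X₁₂≈0 = sym (*-identityˡ _)
  det-lowerBlocks (suc m) {n} X X₁₂≈0 = begin
    det (blocks X)
      ≈⟨ sum-++ (suc m) {n} (λ j → sgn j * (X (inj₁ zero) (splitAt (suc m) j) * minor j)) ⟩
    sumFin (λ j → sgn (j ↑ˡ n) * (X (inj₁ zero) (splitAt (suc m) (j ↑ˡ n)) * minor (j ↑ˡ n)))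
      + sumFin (λ j → sgn (suc m ↑ʳ j) * (X (inj₁ zero) (splitAt (suc m) (suc m ↑ʳ j)) * minor (suc m ↑ʳ j)))
      ≈⟨ +-cong (sum-cong left) (sum-zero right) ⟩
    sumFin (λ j → D * (sgn j * (X (inj₁ zero) (inj₁ j) * det (λ r c → X (inj₁ (suc r)) (inj₁ (punchIn j c)))))) + 0#
      ≈⟨ trans (+-identityʳ _) (trans (sum-*ˡ {suc m} D (λ j → sgn j * (X (inj₁ zero) (inj₁ j) * det (λ r c → X (inj₁ (suc r)) (inj₁ (punchIn j c)))))) (*-comm _ _)) ⟩
    det (λ i j → X (inj₁ i) (inj₁ j)) * D ∎
    where
    D : Carrier
    D = det (λ i j → X (inj₂ i) (inj₂ j))
    minor : Fin (suc m ℕ.+ n) → Carrier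
    minor j = det (λ r c → X (splitAt (suc m) (suc r)) (splitAt (suc m) (punchIn j c)))
    left : ∀ j → sgn (j ↑ˡ n) * (X (inj₁ zero) (splitAt (suc m) (j ↑ˡ n)) * minor (j ↑ˡ n))
               ≈ D * (sgn j * (X (inj₁ zero) (inj₁ j) * det (λ r c → X (inj₁ (suc r)) (inj₁ (punchIn j c)))))
    left j = trans
      (*-cong (reflexive (≡.cong (pow (- 1#)) (Fin.toℕ-↑ˡ j n)))
        (*-cong (reflexive (≡.cong (X (inj₁ zero)) (Fin.splitAt-↑ˡ (suc m) j n)))
          (trans (det-cong {m ℕ.+ n} (λ r c → reflexive (≡.cong (X (splitAt (suc m) (suc r))) (splitAt-punchIn m j c))))
                 (det-lowerBlocks m (λ r c → X (Sum.map suc id r) (Sum.map (punchIn j) id c)) (λ r c → X₁₂≈0 (suc r) c)))))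
      (solve 4 (λ s x a d → s :* (x :* (a :* d)) := d :* (s :* (x :* a))) refl _ _ _ _)
    right : ∀ j → sgn (suc m ↑ʳ j) * (X (inj₁ zero) (splitAt (suc m) (suc m ↑ʳ j)) * minor (suc m ↑ʳ j)) ≈ 0#
    right j = trans (*-congˡ (trans (*-congʳ (trans
      (reflexive (≡.cong (X (inj₁ zero)) (Fin.splitAt-↑ʳ (suc m) n j))) (X₁₂≈0 zero j))) (zeroˡ _))) (zeroʳ _)

  det-upperBlocks : ∀ m {n} (X : BlockMatrix m n) → (∀ i j → X (inj₂ i) (inj₁ j) ≈ 0#) →
    det (blocks X) ≈ det (λ i j → X (inj₁ i) (inj₁ j)) * det (λ i j → X (inj₂ i) (inj₂ j))
  det-upperBlocks m X X₂₁≈0 = begin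
    det (blocks X)                      ≈⟨ det-transpose (blocks X) ⟨
    det (blocks (λ i j → X j i))        ≈⟨ det-lowerBlocks m (λ i j → X j i) (λ i j → X₂₁≈0 j i) ⟩
    det (λ i j → X (inj₁ j) (inj₁ i)) * det (λ i j → X (inj₂ j) (inj₂ i))
      ≈⟨ *-cong (det-transpose (λ i j → X (inj₁ i) (inj₁ j))) (det-transpose (λ i j → X (inj₂ i) (inj₂ j))) ⟩
    det (λ i j → X (inj₁ i) (inj₁ j)) * det (λ i j → X (inj₂ i) (inj₂ j)) ∎

-- The recurrence for complete homogeneous polynomials of an inversion-closed alphabet

module Recurrence {c ℓ} (F : Field c ℓ) where
  open Field F hiding (zero)
  open FieldDefs F
  open IntegerCoefficients F
  open Determinants F
  open Algebra.Properties.Ring ring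
  open Relation.Binary.Reasoning.Setoid setoid

  h-suc : ∀ r z Z → h (ℤ.suc r) (z ∷ Z) ≈ z * h r (z ∷ Z) + h (ℤ.suc r) Z
  h-suc (+ n)        z Z = refl
  h-suc -[1+ zero ]  z Z = sym (trans (+-congʳ (zeroʳ z)) (+-identityˡ _))
  h-suc -[1+ suc n ] z Z = sym (trans (+-congʳ (zeroʳ z)) (+-identityˡ _))

  -- On the empty alphabet `h` is the indicator of 0, an even function. It plays the part of the
  -- unit impulse below.
  h-[]-neg : ∀ r → h (ℤ.- r) [] ≡ h r []
  h-[]-neg (+ zero)  = ≡.refl
  h-[]-neg (+ suc n) = ≡.refl
  h-[]-neg -[1+ n ]  = ≡.refl

  -- Each letter is placed next to its inverse so that the recursion removes one quadratic factor of
  -- the characteristic polynomial at a time.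
  balanced : List Carrier → List Carrier
  balanced []      = 1# ∷ []
  balanced (z ∷ W) = z ∷ z ⁻¹ ∷ balanced W

  size : List Carrier → ℕ
  size W = suc (length W ℕ.* 2)

  -- This is `(S - z)(S - z⁻¹)` for invertible `z`. The constant term is written as 1 rather than
  -- `z * z ⁻¹`, which makes the factor palindromic for every `z`.
  quadratic : Carrier → (ℤ → Carrier) → ℤ → Carrier
  quadratic z f r = f (ℤ.suc (ℤ.suc r)) - (z + z ⁻¹) * f (ℤ.suc r) + f r

  -- The operator p(S), where S is the shift and p the monic polynomial whose
  -- roots are the elements of `balanced W`.
  charOp : List Carrier → (ℤ → Carrier) → ℤ → Carrier
  charOp []      f r = f (ℤ.suc r) - f r
  charOp (z ∷ W) f r = charOp W (quadratic z f) r

  charOp-cong : ∀ W {f g} → (∀ r → f r ≈ g r) → ∀ r → charOp W f r ≈ charOp W g r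
  charOp-cong []      f≈g r = +-cong (f≈g _) (-‿cong (f≈g _))
  charOp-cong (z ∷ W) f≈g r =
    charOp-cong W (λ r → +-cong (+-cong (f≈g _) (-‿cong (*-congˡ (f≈g _)))) (f≈g _)) r

  charOp-+ : ∀ W f g r → charOp W (λ r → f r + g r) r ≈ charOp W f r + charOp W g r
  charOp-+ [] f g r =
    solve 4 (λ a b x y → (a :+ b) :- (x :+ y) := (a :- x) :+ (b :- y)) refl _ _ _ _
  charOp-+ (z ∷ W) f g r = trans
    (charOp-cong W (λ r → solve 7
      (λ q a b x y u v → (a :+ b) :- q :* (x :+ y) :+ (u :+ v) := (a :- q :* x :+ u) :+ (b :- q :* y :+ v))
      refl (z + z ⁻¹) (f (ℤ.suc (ℤ.suc r))) (g (ℤ.suc (ℤ.suc r))) (f (ℤ.suc r)) (g (ℤ.suc r)) (f r) (g r)) r)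
    (charOp-+ W (quadratic z f) (quadratic z g) r)

  charOp-suc : ∀ W f r → charOp W (f ∘ ℤ.suc) r ≡ charOp W f (ℤ.suc r)
  charOp-suc []      f r = ≡.refl
  charOp-suc (z ∷ W) f r = charOp-suc W (quadratic z f) r

  -- The generating function of the `h_k` is the inverse of the product of the `1 - z x`. Each
  -- quadratic factor strips `z` and `z ⁻¹` from the alphabet and advances the index by 2; the last
  -- factor strips the 1 and advances it by 1. What remains is an impulse at `r = -N`.
  charOp-h : ∀ W → All (λ z → z * z ⁻¹ ≈ 1#) W → ∀ r →
             charOp W (λ r → h r (balanced W)) r ≈ h (+ size W ℤ.+ r) []
  charOp-h [] [] r = begin
    h (ℤ.suc r) (1# ∷ []) - h r (1# ∷ [])
      ≈⟨ +-congʳ (h-suc r 1# []) ⟩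
    1# * h r (1# ∷ []) + h (ℤ.suc r) [] - h r (1# ∷ [])
      ≈⟨ solve 2 (λ x y → con (+ 1) :* x :+ y :- x := y) refl _ _ ⟩
    h (ℤ.suc r) [] ∎
  charOp-h (z ∷ W) (zz⁻¹≈1 ∷ inv) r = begin
    charOp W (quadratic z (λ r → h r (balanced (z ∷ W)))) r
      ≈⟨ charOp-cong W kill r ⟩
    charOp W (λ r → h (ℤ.suc (ℤ.suc r)) (balanced W)) r
      ≡⟨ ≡.trans (charOp-suc W (λ r → h (ℤ.suc r) (balanced W)) r) (charOp-suc W (λ r → h r (balanced W)) (ℤ.suc r)) ⟩
    charOp W (λ r → h r (balanced W)) (ℤ.suc (ℤ.suc r))
      ≈⟨ charOp-h W inv _ ⟩
    h (+ size W ℤ.+ ℤ.suc (ℤ.suc r)) []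
      ≡⟨ ≡.cong (λ r → h r []) (shift (+ size W) r) ⟩
    h (+ size (z ∷ W) ℤ.+ r) [] ∎
    where
    shift : ∀ N r → N ℤ.+ (+ 1 ℤ.+ (+ 1 ℤ.+ r)) ≡ + 2 ℤ.+ N ℤ.+ r
    shift = solve-∀
    kill : ∀ r → quadratic z (λ r → h r (balanced (z ∷ W))) r ≈ h (ℤ.suc (ℤ.suc r)) (balanced W)
    kill r = begin
      h₂ - (z + z ⁻¹) * h₁ + h₀
        ≈⟨ solve 5 (λ h₂ h₁ h₀ z z′ → h₂ :- (z :+ z′) :* h₁ :+ h₀
              := (h₂ :- z :* h₁) :- z′ :* h₁ :+ h₀) refl h₂ h₁ h₀ z (z ⁻¹) ⟩
      (h₂ - z * h₁) - z ⁻¹ * h₁ + h₀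
        ≈⟨ +-congʳ (+-cong (+-congʳ (trans (h-suc (ℤ.suc r) z _) (+-congˡ (h-suc (ℤ.suc r) (z ⁻¹) _))))
                           (-‿cong (*-congˡ (h-suc r z _)))) ⟩
      (z * h₁ + (z ⁻¹ * g₁ + k) - z * h₁) - z ⁻¹ * (z * h₀ + g₁) + h₀
        ≈⟨ solve 6 (λ z z′ h₁ h₀ g₁ k → (z :* h₁ :+ (z′ :* g₁ :+ k) :- z :* h₁) :- z′ :* (z :* h₀ :+ g₁) :+ h₀
              -- The constant term 1 of the quadratic factor meets `z * z ⁻¹`; invertibility of the
              -- letter enters exactly here.
              := k :+ (con (+ 1) :- z :* z′) :* h₀) refl z (z ⁻¹) h₁ h₀ g₁ k ⟩
      k + (1# - z * z ⁻¹) * h₀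
        ≈⟨ +-congˡ (*-congʳ (trans (+-congˡ (-‿cong zz⁻¹≈1)) (-‿inverseʳ 1#))) ⟩
      k + 0# * h₀
        ≈⟨ trans (+-congˡ (zeroˡ _)) (+-identityʳ _) ⟩
      k ∎
      where
      h₀ h₁ h₂ g₁ k : Carrier
      h₀ = h r (balanced (z ∷ W))
      h₁ = h (ℤ.suc r) (balanced (z ∷ W))
      h₂ = h (ℤ.suc (ℤ.suc r)) (balanced (z ∷ W))
      g₁ = h (ℤ.suc r) (z ⁻¹ ∷ balanced W)
      k  = h (ℤ.suc (ℤ.suc r)) (balanced W)

  -- Reflecting a sequence reverses the coefficients of the operator. The quadratic factors are
  -- palindromic, and the factor `S - 1` accounts for the sign.
  charOp-reflect : ∀ W f a r →
    charOp W (λ r → f (a ℤ.- r)) r ≈ - charOp W f (a ℤ.- + size W ℤ.- r)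
  charOp-reflect [] f a r = begin
    f (a ℤ.- ℤ.suc r) - f (a ℤ.- r)
      ≈⟨ solve 2 (λ x y → x :- y := :- (y :- x)) refl _ _ ⟩
    - (f (a ℤ.- r) - f (a ℤ.- ℤ.suc r))
      ≡⟨ ≡.cong₂ (λ i j → - (f i - f j)) (e₀ a r) (e₁ a r) ⟩
    - (f (ℤ.suc (a ℤ.- + 1 ℤ.- r)) - f (a ℤ.- + 1 ℤ.- r)) ∎
    where
    e₀ : ∀ a r → a ℤ.- r ≡ + 1 ℤ.+ (a ℤ.- + 1 ℤ.- r)
    e₀ = solve-∀
    e₁ : ∀ a r → a ℤ.- (+ 1 ℤ.+ r) ≡ a ℤ.- + 1 ℤ.- r
    e₁ = solve-∀
  charOp-reflect (z ∷ W) f a r = begin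
    charOp W (quadratic z (λ r → f (a ℤ.- r))) r
      ≈⟨ charOp-cong W reflect r ⟩
    charOp W (λ r → quadratic z f (a ℤ.- + 2 ℤ.- r)) r
      ≈⟨ charOp-reflect W (quadratic z f) (a ℤ.- + 2) r ⟩
    - charOp W (quadratic z f) (a ℤ.- + 2 ℤ.- + size W ℤ.- r)
      ≡⟨ ≡.cong (λ i → - charOp W (quadratic z f) i) (e₃ a (+ size W) r) ⟩
    - charOp W (quadratic z f) (a ℤ.- + size (z ∷ W) ℤ.- r) ∎
    where
    e₀ : ∀ a r → a ℤ.- (+ 1 ℤ.+ (+ 1 ℤ.+ r)) ≡ a ℤ.- + 2 ℤ.- r
    e₀ = solve-∀
    e₁ : ∀ a r → a ℤ.- (+ 1 ℤ.+ r) ≡ + 1 ℤ.+ (a ℤ.- + 2 ℤ.- r)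
    e₁ = solve-∀
    e₂ : ∀ a r → a ℤ.- r ≡ + 1 ℤ.+ (+ 1 ℤ.+ (a ℤ.- + 2 ℤ.- r))
    e₂ = solve-∀
    e₃ : ∀ a N r → a ℤ.- + 2 ℤ.- N ℤ.- r ≡ a ℤ.- (+ 2 ℤ.+ N) ℤ.- r
    e₃ = solve-∀
    reflect : ∀ r → quadratic z (λ r → f (a ℤ.- r)) r ≈ quadratic z f (a ℤ.- + 2 ℤ.- r)
    reflect r = trans
      (+-cong (+-cong (reflexive (≡.cong f (e₀ a r))) (-‿cong (*-congˡ (reflexive (≡.cong f (e₁ a r))))))
              (reflexive (≡.cong f (e₂ a r))))
      (solve 4 (λ q x y u → x :- q :* y :+ u := u :- q :* y :+ x) refl _ _ _ _)

  -- Continues k ↦ h_k to a solution of the linear recurrence on all of ℤ: the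
  -- added term vanishes for k > -N, and is forced by the symmetry of the
  -- alphabet under inversion.
  hExt : List Carrier → ℤ → Carrier
  hExt W r = h r (balanced W) + h (ℤ.- (+ size W) ℤ.- r) (balanced W)

  hExt-reflect : ∀ W r → hExt W (ℤ.- (+ size W) ℤ.- r) ≈ hExt W r
  hExt-reflect W r = trans (+-comm _ _)
    (+-congʳ (reflexive (≡.cong (λ i → h i (balanced W)) (e (+ size W) r))))
    where
    e : ∀ N r → ℤ.- N ℤ.- (ℤ.- N ℤ.- r) ≡ r
    e = solve-∀

  -- The impulses of `h` and of its mirror image both sit at `r = -N`, with opposite signs.
  charOp-hExt : ∀ W → All (λ z → z * z ⁻¹ ≈ 1#) W → ∀ r → charOp W (hExt W) r ≈ 0#
  charOp-hExt W inv r = begin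
    charOp W (hExt W) r
      ≈⟨ charOp-+ W H (λ r → H (ℤ.- N ℤ.- r)) r ⟩
    charOp W H r + charOp W (λ r → H (ℤ.- N ℤ.- r)) r
      ≈⟨ +-cong (charOp-h W inv r) (trans (charOp-reflect W H (ℤ.- N) r) (-‿cong (charOp-h W inv _))) ⟩
    h (N ℤ.+ r) [] - h (N ℤ.+ (ℤ.- N ℤ.- N ℤ.- r)) []
      ≡⟨ ≡.cong (λ x → h (N ℤ.+ r) [] - x) (≡.trans (≡.cong (λ i → h i []) (e N r)) (h-[]-neg (N ℤ.+ r))) ⟩
    h (N ℤ.+ r) [] - h (N ℤ.+ r) []
      ≈⟨ -‿inverseʳ _ ⟩
    0# ∎
    where
    N : ℤ
    N = + size W
    H : ℤ → Carrier
    H r = h r (balanced W)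
    e : ∀ N r → N ℤ.+ (ℤ.- N ℤ.- N ℤ.- r) ≡ ℤ.- (N ℤ.+ r)
    e = solve-∀

  eval : ℕ → (ℕ → Carrier) → (ℕ → Carrier) → Carrier
  eval n a φ = sumFin {n} (λ k → a (toℕ k) * φ (toℕ k))

  eval-congʳ : ∀ n a {φ ψ} → (∀ k → φ k ≈ ψ k) → eval n a φ ≈ eval n a ψ
  eval-congʳ n a φ≈ψ = sum-cong {n} (λ k → *-congˡ (φ≈ψ (toℕ k)))

  eval-extend : ∀ n a φ → a n ≈ 0# → eval (suc n) a φ ≈ eval n a φ
  eval-extend zero    a φ aₙ≈0 = trans (+-identityʳ _) (trans (*-congʳ aₙ≈0) (zeroˡ _))
  eval-extend (suc n) a φ aₙ≈0 = +-congˡ (eval-extend n (a ∘ suc) (φ ∘ suc) aₙ≈0)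

  eval-combination : ∀ n q a b d φ → eval n (λ k → a k - q * b k + d k) φ ≈ eval n a φ - q * eval n b φ + eval n d φ
  eval-combination zero    q a b d φ = solve 1 (λ q → con (+ 0) := con (+ 0) :- q :* con (+ 0) :+ con (+ 0)) refl q
  eval-combination (suc n) q a b d φ = trans (+-congˡ (eval-combination n q (a ∘ suc) (b ∘ suc) (d ∘ suc) (φ ∘ suc)))
    (solve 8 (λ q a b d φ x y z → (a :- q :* b :+ d) :* φ :+ (x :- q :* y :+ z)
                := (a :* φ :+ x) :- q :* (b :* φ :+ y) :+ (d :* φ :+ z)) refl q _ _ _ _ _ _ _)

  shift : (ℕ → Carrier) → ℕ → Carrier
  shift a zero    = 0#
  shift a (suc k) = a k

  eval-shift : ∀ n a φ → eval (suc n) (shift a) φ ≈ eval n a (φ ∘ suc)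
  eval-shift n a φ = trans (+-congʳ (zeroˡ _)) (+-identityˡ _)

  -- The coefficients of the polynomial behind `charOp`, lowest degree first; `shift` multiplies by
  -- the variable. They continue by zeros, so the three summands can be evaluated over a common
  -- range.
  charPoly : List Carrier → ℕ → Carrier
  charPoly []      zero          = - 1#
  charPoly []      (suc zero)    = 1#
  charPoly []      (suc (suc _)) = 0#
  charPoly (z ∷ W) k = shift (shift (charPoly W)) k - (z + z ⁻¹) * shift (charPoly W) k + charPoly W k

  charPoly-constant : ∀ W → charPoly W 0 ≈ - 1#
  charPoly-constant []      = refl
  charPoly-constant (z ∷ W) = trans
    (solve 2 (λ q x → con (+ 0) :- q :* con (+ 0) :+ x := x) refl _ _) (charPoly-constant W)

  charPoly-beyond : ∀ W k → size W ℕ.< k → charPoly W k ≈ 0#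
  charPoly-beyond []      (suc (suc k)) _ = refl
  charPoly-beyond []      (suc zero)    (ℕ.s≤s ())
  charPoly-beyond (z ∷ W) (suc (suc k)) (ℕ.s≤s (ℕ.s≤s size<k)) = trans
    (+-cong (+-cong (charPoly-beyond W k size<k) (-‿cong (*-congˡ (charPoly-beyond W (suc k) (ℕ.m<n⇒m<1+n size<k)))))
            (charPoly-beyond W (suc (suc k)) (ℕ.m<n⇒m<1+n (ℕ.m<n⇒m<1+n size<k))))
    (solve 1 (λ q → con (+ 0) :- q :* con (+ 0) :+ con (+ 0) := con (+ 0)) refl _)

  charPoly-monic : ∀ W → charPoly W (size W) ≈ 1#
  charPoly-monic []      = refl
  charPoly-monic (z ∷ W) = trans
    (+-cong (+-cong (charPoly-monic W) (-‿cong (*-congˡ (charPoly-beyond W (suc (size W)) ℕ.≤-refl))))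
            (charPoly-beyond W (suc (suc (size W))) (ℕ.m<n⇒m<1+n ℕ.≤-refl)))
    (solve 1 (λ q → con (+ 1) :- q :* con (+ 0) :+ con (+ 0) := con (+ 1)) refl _)

  charOp-eval : ∀ W f r → charOp W f r ≈ eval (suc (size W)) (charPoly W) (λ k → f (+ k ℤ.+ r))
  charOp-eval [] f r = trans
    (solve 2 (λ x y → x :- y := con -[1+ 0 ] :* y :+ (con (+ 1) :* x :+ con (+ 0))) refl _ _)
    (+-congʳ (*-congˡ (reflexive (≡.cong f (≡.sym (ℤ.+-identityˡ r))))))
  charOp-eval (z ∷ W) f r = begin
    charOp W (quadratic z f) r
      ≈⟨ charOp-eval W (quadratic z f) r ⟩
    eval n p (λ k → quadratic z f (+ k ℤ.+ r))
      ≈⟨ eval-congʳ n p (λ k → +-congʳ {φ k} (+-cong (reflexive (≡.cong f (e₂ (+ k) r)))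
           (-‿cong (*-congˡ {q} (reflexive (≡.cong f (e₁ (+ k) r))))))) ⟩
    eval n p (λ k → φ₂ k - q * φ₁ k + φ k)
      -- `eval-combination` is linear in the coefficients, but the combination occurs in the
      -- sequence; commutativity exchanges the two arguments.
      ≈⟨ trans (eval-comm n p (λ k → φ₂ k - q * φ₁ k + φ k)) (trans (eval-combination n q φ₂ φ₁ φ p)
           (+-cong (+-cong (eval-comm n φ₂ p) (-‿cong (*-congˡ (eval-comm n φ₁ p)))) (eval-comm n φ p))) ⟩
    eval n p φ₂ - q * eval n p φ₁ + eval n p φ
      ≈⟨ +-cong (+-cong
           (trans (eval-shift (suc n) (shift p) φ) (eval-shift n p φ₁))
           (-‿cong (*-congˡ (trans (eval-shift (suc n) p φ) (eval-extend n p φ₁ (charPoly-beyond W n ℕ.≤-refl))))))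
           (trans (eval-extend (suc n) p φ (charPoly-beyond W (suc n) (ℕ.m<n⇒m<1+n ℕ.≤-refl)))
                  (eval-extend n p φ (charPoly-beyond W n ℕ.≤-refl))) ⟨
    eval (suc (suc n)) (shift (shift p)) φ - q * eval (suc (suc n)) (shift p) φ + eval (suc (suc n)) p φ
      ≈⟨ eval-combination (suc (suc n)) q (shift (shift p)) (shift p) p φ ⟨
    eval (suc (suc n)) (charPoly (z ∷ W)) φ ∎
    where
    n : ℕ
    n = suc (size W)
    p φ φ₁ φ₂ : ℕ → Carrier
    p = charPoly W
    φ k = f (+ k ℤ.+ r)
    φ₁ k = φ (suc k)
    φ₂ k = φ (suc (suc k))
    q : Carrier
    q = z + z ⁻¹
    eval-comm : ∀ n a φ → eval n a φ ≈ eval n φ a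
    eval-comm n a φ = sum-cong {n} (λ k → *-comm _ _)
    e₁ : ∀ k r → + 1 ℤ.+ (k ℤ.+ r) ≡ + 1 ℤ.+ k ℤ.+ r
    e₁ = solve-∀
    e₂ : ∀ k r → + 1 ℤ.+ (+ 1 ℤ.+ (k ℤ.+ r)) ≡ + 2 ℤ.+ k ℤ.+ r
    e₂ = solve-∀

  -- The constant coefficient is -1, so the relation can be solved for its lowest term. In this
  -- downward form it describes the column that enters when all indices decrease by one.
  hExt-recurrence : ∀ W → All (λ z → z * z ⁻¹ ≈ 1#) W → ∀ r →
    hExt W r ≈ sumFin {size W} (λ k → charPoly W (suc (toℕ k)) * hExt W (+ suc (toℕ k) ℤ.+ r))
  hExt-recurrence W inv r = begin
    hExt W r
      ≈⟨ solve 2 (λ x s → x := s :- (con -[1+ 0 ] :* x :+ s)) refl (hExt W r) s ⟩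
    s - (- 1# * hExt W r + s)
      ≈⟨ +-congˡ (-‿cong (+-congʳ (*-cong (sym (charPoly-constant W)) (reflexive (≡.cong (hExt W) (≡.sym (ℤ.+-identityˡ r))))))) ⟩
    s - eval (suc (size W)) (charPoly W) (λ k → hExt W (+ k ℤ.+ r))
      ≈⟨ +-congˡ (-‿cong (trans (sym (charOp-eval W (hExt W) r)) (charOp-hExt W inv r))) ⟩
    s - 0#
      ≈⟨ solve 1 (λ s → s :- con (+ 0) := s) refl s ⟩
    s ∎
    where
    s : Carrier
    s = sumFin {size W} (λ k → charPoly W (suc (toℕ k)) * hExt W (+ suc (toℕ k) ℤ.+ r))

-- Companion matrices, column differences and symmetric blocks

module StructuredDeterminants {c ℓ} (F : Field c ℓ) where
  open Field F hiding (zero)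
  open FieldDefs F
  open IntegerCoefficients F
  open Determinants F
  open Algebra.Properties.Ring ring
  open Relation.Binary.Reasoning.Setoid setoid

  sum-δʳ : ∀ {n} (f : Fin n → Carrier) j → sumFin (λ k → f k * δ k j) ≈ f j
  sum-δʳ {n} f j = trans (sum-cong {n} (λ k → trans (*-comm _ _) (*-congʳ (reflexive (δ-sym k j))))) (sum-δ j f)

  pow-even : ∀ m → pow (- 1#) (m ℕ.+ m) ≈ 1#
  pow-even zero    = refl
  pow-even (suc m) = begin
    - 1# * pow (- 1#) (m ℕ.+ suc m)      ≡⟨ ≡.cong (λ k → - 1# * pow (- 1#) k) (ℕ.+-suc m m) ⟩
    - 1# * (- 1# * pow (- 1#) (m ℕ.+ m)) ≈⟨ solve 1 (λ x → con -[1+ 0 ] :* (con -[1+ 0 ] :* x) := x) refl _ ⟩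
    pow (- 1#) (m ℕ.+ m)                 ≈⟨ pow-even m ⟩
    1#                                   ∎

  det-zeroColumn : ∀ {n} (M : Matrix (suc n)) → (∀ i → M i zero ≈ 0#) → det M ≈ 0#
  det-zeroColumn {n} M M₀≈0 = trans (det-column M) (sum-zero {suc n} λ i →
    trans (*-congˡ {sgn i} (trans (*-congʳ {det (λ r c → M (punchIn i r) (suc c))} (M₀≈0 i)) (zeroˡ _))) (zeroʳ _))

  det-firstColumn : ∀ {n} (M : Matrix (suc n)) → (∀ i → M (suc i) zero ≈ 0#) →
                    det M ≈ M zero zero * det (λ i j → M (suc i) (suc j))
  det-firstColumn {n} M M₀≈0 = trans (det-column M) (trans
    (+-cong (*-identityˡ _) (sum-zero {n} λ i → trans (*-congˡ {sgn (suc i)} (trans (*-congʳ (M₀≈0 i)) (zeroˡ _))) (zeroʳ _)))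
    (+-identityʳ _))

  det-firstRow : ∀ {n} (M : Matrix (suc n)) → (∀ j → M zero (suc j) ≈ 0#) →
                 det M ≈ M zero zero * det (λ i j → M (suc i) (suc j))
  det-firstRow {n} M M₀≈0 = trans
    (+-cong (*-identityˡ _) (sum-zero {n} λ j → trans (*-congˡ {sgn (suc j)} (trans (*-congʳ (M₀≈0 j)) (zeroˡ _))) (zeroʳ _)))
    (+-identityʳ _)

  -- Multiplication from the right moves every column one place to the right, drops the last one and
  -- fills column 0 with the combination `a` of the old columns.
  companion : ∀ {n} → (Fin (suc n) → Carrier) → Matrix (suc n)
  companion a k zero    = a k
  companion a k (suc j) = δ k (inject₁ j)

  det-companion : ∀ n (a : ℕ → Carrier) → det {suc n} (companion (a ∘ toℕ)) ≈ pow (- 1#) n * a n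
  det-companion zero    a = solve 1 (λ x → con (+ 1) :* (x :* con (+ 1)) :+ con (+ 0) := con (+ 1) :* x) refl _
  det-companion (suc n) a = begin
    1# * (a 0 * det {suc n} (λ r c → C (suc r) (suc c)))
      + (- 1# * 1# * (1# * det {suc n} (λ r c → C (suc r) (punchIn (suc zero) c))) + rest)
      -- The minor of `a 0` begins with a zero column; the only other nonzero entry of the row is
      -- the 1 in column 1, whose minor is the companion matrix of the shifted coefficients.
      ≈⟨ +-cong (*-congˡ (*-congˡ (det-zeroColumn {n} (λ r c → C (suc r) (suc c)) (λ _ → refl))))
           (+-cong (*-congˡ (*-congˡ (trans (det-cong {suc n} smaller) (det-companion n (a ∘ suc)))))
                   (sum-zero {n} λ j → trans (*-congˡ {sgn (suc (suc j))} (zeroˡ _)) (zeroʳ _))) ⟩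
    1# * (a 0 * 0#) + (- 1# * 1# * (1# * (pow (- 1#) n * a (suc n))) + 0#)
      ≈⟨ solve 3 (λ x s y → con (+ 1) :* (x :* con (+ 0)) :+ (con -[1+ 0 ] :* con (+ 1) :* (con (+ 1) :* (s :* y)) :+ con (+ 0))
                := con -[1+ 0 ] :* s :* y) refl _ _ _ ⟩
    - 1# * pow (- 1#) n * a (suc n) ∎
    where
    C : Matrix (suc (suc n))
    C = companion (a ∘ toℕ)
    rest : Carrier
    rest = sumFin {n} (λ j → sgn (suc (suc j)) * (C zero (suc (suc j)) * det {suc n} (λ r c → C (suc r) (punchIn (suc (suc j)) c))))
    smaller : ∀ r c → C (suc r) (punchIn (suc zero) c) ≈ companion (a ∘ suc ∘ toℕ) r c
    smaller r zero    = refl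
    smaller r (suc c) = refl

  -- The hypothesis on column 0 of g says that it is s times column 1, so that the
  -- differences of consecutive columns start with 1 - s times column 1.
  det-columnDifferences : ∀ {n} s (g : Fin (suc n) → ℕ → Carrier) → (∀ i → g i 0 ≈ s * g i 1) →
    det (λ i j → g i (suc (toℕ j)) - g i (toℕ j)) ≈ (1# - s) * det (λ i j → g i (suc (toℕ j)))
  det-columnDifferences {n} s g g₀≈sg₁ = begin
    det (λ i j → g i (suc (toℕ j)) - g i (toℕ j))
      ≈⟨ det-cong (λ i j → sym (product i j)) ⟩
    det (λ i j → sumFin {suc n} (λ k → g i (suc (toℕ k)) * U k j))
      ≈⟨ det-* (λ i j → g i (suc (toℕ j))) U ⟩
    det (λ i j → g i (suc (toℕ j))) * det U
      ≈⟨ *-congˡ (det-firstColumn U (λ i → zeroʳ _)) ⟩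
    det (λ i j → g i (suc (toℕ j))) * ((1# - s) * 1# * det (λ i j → U (suc i) (suc j)))
      ≈⟨ *-congˡ (*-congˡ (det-unitriangular {n} (λ i j → U (suc i) (suc j)) diagonal below)) ⟩
    det (λ i j → g i (suc (toℕ j))) * ((1# - s) * 1# * 1#)
      ≈⟨ solve 2 (λ d x → d :* (x :* con (+ 1) :* con (+ 1)) := x :* d) refl _ _ ⟩
    (1# - s) * det (λ i j → g i (suc (toℕ j))) ∎
    where
    U : Matrix (suc n)
    -- Column 0 of `g` is not a column of the left factor; the hypothesis expresses it through
    -- column 1, which makes `U` square and triangular.
    U k zero    = (1# - s) * δ k zero
    U k (suc j) = δ k (suc j) - δ k (inject₁ j)
    diagonal : ∀ i → δ (suc i) (suc i) - δ (suc i) (inject₁ i) ≈ 1#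
    diagonal i = trans (+-cong (reflexive (δ-refl i)) (-‿cong (reflexive (≡.trans (δ-sym (suc i) (inject₁ i))
      (δ-< (ℕ.≤-reflexive (≡.cong suc (Fin.toℕ-inject₁ i))))))))
      (solve 0 (con (+ 1) :- con (+ 0) := con (+ 1)) refl)
    below : ∀ i j → j Fin.< i → δ (suc i) (suc j) - δ (suc i) (inject₁ j) ≈ 0#
    below i j j<i = trans (+-cong (reflexive (≡.trans (δ-sym i j) (δ-< j<i)))
      (-‿cong (reflexive (≡.trans (δ-sym (suc i) (inject₁ j))
        (δ-< (ℕ.m≤n⇒m≤1+n (ℕ.≤-trans (ℕ.≤-reflexive (≡.cong suc (Fin.toℕ-inject₁ j))) j<i)))))))
      (-‿inverseʳ 0#)
    product : ∀ i j → sumFin {suc n} (λ k → g i (suc (toℕ k)) * U k j) ≈ g i (suc (toℕ j)) - g i (toℕ j)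
    product i zero = begin
      sumFin {suc n} (λ k → g i (suc (toℕ k)) * ((1# - s) * δ k zero))
        ≈⟨ sum-cong {suc n} (λ k → solve 3 (λ x y z → x :* (y :* z) := y :* (x :* z)) refl (g i (suc (toℕ k))) (1# - s) (δ k zero)) ⟩
      sumFin {suc n} (λ k → (1# - s) * (g i (suc (toℕ k)) * δ k zero))
        ≈⟨ sum-*ˡ {suc n} (1# - s) (λ k → g i (suc (toℕ k)) * δ k zero) ⟩
      (1# - s) * sumFin {suc n} (λ k → g i (suc (toℕ k)) * δ k zero)
        ≈⟨ *-congˡ (sum-δʳ {suc n} (λ k → g i (suc (toℕ k))) zero) ⟩
      (1# - s) * g i 1
        ≈⟨ solve 2 (λ s x → (con (+ 1) :- s) :* x := x :- s :* x) refl s (g i 1) ⟩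
      g i 1 - s * g i 1
        ≈⟨ +-congˡ (-‿cong (sym (g₀≈sg₁ i))) ⟩
      g i 1 - g i 0 ∎
    product i (suc j) = begin
      sumFin {suc n} (λ k → a k * (δ k (suc j) - δ k (inject₁ j)))
        ≈⟨ sum-cong {suc n} (λ k → solve 3 (λ x y z → x :* (y :- z) := x :* y :+ con -[1+ 0 ] :* (x :* z)) refl (a k) (δ k (suc j)) (δ k (inject₁ j))) ⟩
      sumFin {suc n} (λ k → a k * δ k (suc j) + - 1# * (a k * δ k (inject₁ j)))
        ≈⟨ sum-+ {suc n} (λ k → a k * δ k (suc j)) (λ k → - 1# * (a k * δ k (inject₁ j))) ⟩
      sumFin {suc n} (λ k → a k * δ k (suc j)) + sumFin {suc n} (λ k → - 1# * (a k * δ k (inject₁ j)))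
        ≈⟨ +-cong (sum-δʳ {suc n} a (suc j)) (trans (sum-*ˡ {suc n} (- 1#) (λ k → a k * δ k (inject₁ j))) (*-congˡ (sum-δʳ {suc n} a (inject₁ j)))) ⟩
      a (suc j) + - 1# * a (inject₁ j)
        ≈⟨ solve 2 (λ x y → x :+ con -[1+ 0 ] :* y := x :- y) refl _ _ ⟩
      a (suc j) - a (inject₁ j)
        ≡⟨ ≡.cong (λ k → a (suc j) - g i (suc k)) (Fin.toℕ-inject₁ j) ⟩
      g i (suc (suc (toℕ j))) - g i (suc (toℕ j)) ∎
      where
      a : Fin (suc n) → Carrier
      a k = g i (suc (toℕ k))

  fromBlocks : ∀ {m n} → Matrix m → (Fin m → Fin n → Carrier) → (Fin n → Fin m → Carrier) → Matrix n → BlockMatrix m n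
  fromBlocks P Q R S (inj₁ i) (inj₁ j) = P i j
  fromBlocks P Q R S (inj₁ i) (inj₂ j) = Q i j
  fromBlocks P Q R S (inj₂ i) (inj₁ j) = R i j
  fromBlocks P Q R S (inj₂ i) (inj₂ j) = S i j

  det-blocks-* : ∀ m {n} (X Y : BlockMatrix m n) →
    det (blocks (λ i j → sumFin (λ k → X i (inj₁ k) * Y (inj₁ k) j) + sumFin (λ k → X i (inj₂ k) * Y (inj₂ k) j)))
      ≈ det (blocks X) * det (blocks Y)
  det-blocks-* m {n} X Y = trans
    (det-cong {m ℕ.+ n} (λ i j → sym (trans
      (sum-++ m {n} (λ k → blocks X i k * blocks Y k j))
      (+-cong (sum-cong {m} (λ k → reflexive (≡.cong (λ s → X (splitAt m i) s * Y s (splitAt m j)) (Fin.splitAt-↑ˡ m k n))))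
              (sum-cong {n} (λ k → reflexive (≡.cong (λ s → X (splitAt m i) s * Y s (splitAt m j)) (Fin.splitAt-↑ʳ m n k))))))))
    (det-* (blocks X) (blocks Y))

  det-unipotentBlocks : ∀ m (B : Matrix m) → det (blocks (fromBlocks δ B (λ _ _ → 0#) δ)) ≈ 1#
  det-unipotentBlocks m B = trans (det-upperBlocks m (fromBlocks δ B (λ _ _ → 0#) δ) (λ _ _ → refl))
    (trans (*-cong det-δ det-δ) (*-identityˡ 1#))
    where
    det-δ : det {m} δ ≈ 1#
    det-δ = det-unitriangular {m} δ (reflexive ∘ δ-refl) (λ i j j<i → reflexive (≡.trans (δ-sym i j) (δ-< j<i)))

  -- Subtracting the first block column from the second and then adding the second block row to the
  -- first makes the matrix block triangular. Both operations are unipotent, so no division by 2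
  -- occurs.
  det-symmetricBlocks : ∀ m (P Q : Matrix m) →
    det (blocks (fromBlocks P Q Q P)) ≈ det (λ i j → P i j + Q i j) * det (λ i j → P i j - Q i j)
  det-symmetricBlocks m P Q = begin
    det (blocks Y)
      ≈⟨ trans (*-cong (det-unipotentBlocks m δ) (trans (*-congˡ (det-unipotentBlocks m -δ)) (*-identityʳ _))) (*-identityˡ _) ⟨
    det (blocks L) * (det (blocks Y) * det (blocks R))
      ≈⟨ *-congˡ (det-blocks-* m Y R) ⟨
    det (blocks L) * det (blocks (λ i j → sumFin (λ k → Y i (inj₁ k) * R (inj₁ k) j) + sumFin (λ k → Y i (inj₂ k) * R (inj₂ k) j)))
      ≈⟨ *-congˡ (det-cong {m ℕ.+ m} (λ i j → YR (splitAt m i) (splitAt m j))) ⟩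
    det (blocks L) * det (blocks Z)
      ≈⟨ det-blocks-* m L Z ⟨
    det (blocks (λ i j → sumFin (λ k → L i (inj₁ k) * Z (inj₁ k) j) + sumFin (λ k → L i (inj₂ k) * Z (inj₂ k) j)))
      ≈⟨ det-cong {m ℕ.+ m} (λ i j → LZ (splitAt m i) (splitAt m j)) ⟩
    det (blocks (fromBlocks (λ i j → P i j + Q i j) (λ _ _ → 0#) Q (λ i j → P i j - Q i j)))
      ≈⟨ det-lowerBlocks m (fromBlocks (λ i j → P i j + Q i j) (λ _ _ → 0#) Q (λ i j → P i j - Q i j)) (λ _ _ → refl) ⟩
    det (λ i j → P i j + Q i j) * det (λ i j → P i j - Q i j) ∎
    where
    -δ : Matrix m
    -δ i j = - δ i j
    L R Y Z : BlockMatrix m m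
    L = fromBlocks δ δ (λ _ _ → 0#) δ
    R = fromBlocks δ -δ (λ _ _ → 0#) δ
    Y = fromBlocks P Q Q P
    Z = fromBlocks P (λ i j → Q i j - P i j) Q (λ i j → P i j - Q i j)
    sum-δ⁻ : ∀ (f : Fin m → Carrier) j → sumFin (λ k → f k * - δ k j) ≈ - f j
    sum-δ⁻ f j = trans (sum-cong {m} (λ k → solve 2 (λ x y → x :* :- y := con -[1+ 0 ] :* (x :* y)) refl (f k) (δ k j)))
      (trans (sum-*ˡ {m} (- 1#) (λ k → f k * δ k j)) (trans (*-congˡ (sum-δʳ f j)) (-1*x≈-x _)))
    sum-0ʳ : ∀ (f : Fin m → Carrier) → sumFin (λ k → f k * 0#) ≈ 0#
    sum-0ʳ f = sum-zero {m} (λ k → zeroʳ _)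
    sum-0ˡ : ∀ (f : Fin m → Carrier) → sumFin (λ k → 0# * f k) ≈ 0#
    sum-0ˡ f = sum-zero {m} (λ k → zeroˡ _)
    YR : ∀ i j → sumFin (λ k → Y i (inj₁ k) * R (inj₁ k) j) + sumFin (λ k → Y i (inj₂ k) * R (inj₂ k) j) ≈ Z i j
    YR (inj₁ i) (inj₁ j) = trans (+-cong (sum-δʳ (P i) j) (sum-0ʳ (Q i))) (+-identityʳ _)
    YR (inj₁ i) (inj₂ j) = trans (+-cong (sum-δ⁻ (P i) j) (sum-δʳ (Q i) j)) (+-comm _ _)
    YR (inj₂ i) (inj₁ j) = trans (+-cong (sum-δʳ (Q i) j) (sum-0ʳ (P i))) (+-identityʳ _)
    YR (inj₂ i) (inj₂ j) = trans (+-cong (sum-δ⁻ (Q i) j) (sum-δʳ (P i) j)) (+-comm _ _)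
    LZ : ∀ i j → sumFin (λ k → L i (inj₁ k) * Z (inj₁ k) j) + sumFin (λ k → L i (inj₂ k) * Z (inj₂ k) j)
               ≈ fromBlocks (λ i j → P i j + Q i j) (λ _ _ → 0#) Q (λ i j → P i j - Q i j) i j
    LZ (inj₁ i) (inj₁ j) = +-cong (sum-δ i (λ k → P k j)) (sum-δ i (λ k → Q k j))
    LZ (inj₁ i) (inj₂ j) = trans (+-cong (sum-δ i (λ k → Q k j - P k j)) (sum-δ i (λ k → P k j - Q k j)))
      (solve 2 (λ p q → (q :- p) :+ (p :- q) := con (+ 0)) refl (P i j) (Q i j))
    LZ (inj₂ i) (inj₁ j) = trans (+-cong (sum-0ˡ (λ k → P k j)) (sum-δ i (λ k → Q k j))) (+-identityˡ _)
    LZ (inj₂ i) (inj₂ j) = trans (+-cong (sum-0ˡ (λ k → Q k j - P k j)) (sum-δ i (λ k → P k j - Q k j))) (+-identityˡ _)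

-- The rows of the partition (±μ)

if-true : ∀ {a} {A : Set a} b {x y : A} → T b → (if b then x else y) ≡ x
if-true true _ = ≡.refl

if-false : ∀ {a} {A : Set a} b {x y : A} → ¬ T b → (if b then x else y) ≡ y
if-false true  ¬t = ⊥-elim (¬t _)
if-false false _  = ≡.refl

pos-∸ : ∀ {a b} → b ℕ.≤ a → + (a ∸ b) ≡ + a ℤ.- + b
pos-∸ {a} {b} b≤a = ≡.trans (≡.sym (ℤ.⊖-≥ b≤a)) (≡.sym (ℤ.m-n≡m⊖n a b))

-- (±μ)_{2m+1} for the sequence p of parts of μ, as a function of the 0-based row.
doubled : ℕ → (ℕ → ℕ) → ℕ → ℤ
doubled m p k =
  if k <ᵇ m then + p 0 ℤ.+ + p k
  else if k ≡ᵇ m then + p 0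
  else + p 0 ℤ.- + p ((2 ℕ.* m) ∸ k)

doubled-top : ∀ {m k} p → k ℕ.< m → doubled m p k ≡ + p 0 ℤ.+ + p k
doubled-top {m} {k} p k<m = if-true (k <ᵇ m) (ℕ.<⇒<ᵇ k<m)

doubled-middle : ∀ m p → doubled m p m ≡ + p 0
doubled-middle m p = ≡.trans (if-false (m <ᵇ m) (λ t → ℕ.<-irrefl ≡.refl (ℕ.<ᵇ⇒< m m t)))
                             (if-true (m ≡ᵇ m) (ℕ.≡⇒≡ᵇ m m ≡.refl))

doubled-bottom : ∀ {m k} p → m ℕ.< k → doubled m p k ≡ + p 0 ℤ.- + p ((2 ℕ.* m) ∸ k)
doubled-bottom {m} {k} p m<k = ≡.trans
  (if-false (k <ᵇ m) (λ t → ℕ.<-asym m<k (ℕ.<ᵇ⇒< k m t)))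
  (if-false (k ≡ᵇ m) (λ t → ℕ.<-irrefl (≡.sym (ℕ.≡ᵇ⇒≡ k m t)) m<k))

doubled-mirror : ∀ {m i} p → i ℕ.< m → doubled m p ((m ℕ.+ m) ∸ i) ≡ + p 0 ℤ.- + p i
doubled-mirror {m} {i} p i<m = ≡.trans
  (doubled-bottom p (ℕ.≤-trans (ℕ.≤-reflexive (≡.sym (ℕ.+-comm m 1))) (ℕ.≤-trans (ℕ.+-monoʳ-≤ m (ℕ.m<n⇒0<n∸m i<m))
    (ℕ.≤-reflexive (≡.sym (ℕ.+-∸-assoc m (ℕ.<⇒≤ i<m)))))))
  (≡.cong (λ k → + p 0 ℤ.- + p k) (≡.trans
    (≡.cong (λ M → M ∸ ((m ℕ.+ m) ∸ i)) (≡.cong (m ℕ.+_) (ℕ.+-identityʳ m)))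
    (ℕ.m∸[m∸n]≡n (ℕ.≤-trans (ℕ.<⇒≤ i<m) (ℕ.m≤m+n m m)))))

-- The factorization for a reflection-invariant solution of the recurrence

module Factorization {c ℓ} (F : Field c ℓ) where
  open Field F hiding (zero)
  open FieldDefs F
  open IntegerCoefficients F
  open Determinants F
  open StructuredDeterminants F
  open Algebra.Properties.Ring ring
  open Relation.Binary.Reasoning.Setoid setoid

  -- To be used with `f = hExt W` and `a` the coefficients of the characteristic polynomial above
  -- the constant one. The zeros at `-1, ..., -2m` fill the gap between the value 1 at 0 and its
  -- mirror image at `-N`.
  module Symmetric
    (m : ℕ) (f : ℤ → Carrier) (a : ℕ → Carrier)
    (monic : a (m ℕ.+ m) ≈ 1#)
    (recurrence : ∀ r → f r ≈ sumFin {suc (m ℕ.+ m)} (λ k → a (toℕ k) * f (+ suc (toℕ k) ℤ.+ r)))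
    (reflect : ∀ r → f (ℤ.- (+ suc (m ℕ.+ m)) ℤ.- r) ≈ f r)
    (f₀≈1 : f (+ 0) ≈ 1#)
    (f₋≈0 : ∀ k → k ℕ.< m ℕ.+ m → f -[1+ k ] ≈ 0#)
    where

    N : ℕ
    N = suc (m ℕ.+ m)

    det-suc : ∀ (l : Fin N → ℤ) →
      det (λ i j → f (l i ℤ.+ + toℕ j)) ≈ det (λ i j → f (ℤ.suc (l i) ℤ.+ + toℕ j))
    det-suc l = begin
      det (λ i j → f (l i ℤ.+ + toℕ j))
        ≈⟨ det-cong {N} product ⟩
      det (λ i j → sumFin {N} (λ k → f (ℤ.suc (l i) ℤ.+ + toℕ k) * companion (a ∘ toℕ) k j))
        ≈⟨ det-* {N} (λ i j → f (ℤ.suc (l i) ℤ.+ + toℕ j)) (companion (a ∘ toℕ)) ⟩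
      det (λ i j → f (ℤ.suc (l i) ℤ.+ + toℕ j)) * det {N} (companion (a ∘ toℕ))
        -- `N` is odd, so the sign is an even power of -1; the other factor is the leading
        -- coefficient 1.
        ≈⟨ *-congˡ (trans (det-companion (m ℕ.+ m) a) (trans (*-cong (pow-even m) monic) (*-identityˡ 1#))) ⟩
      det (λ i j → f (ℤ.suc (l i) ℤ.+ + toℕ j)) * 1#
        ≈⟨ *-identityʳ _ ⟩
      det (λ i j → f (ℤ.suc (l i) ℤ.+ + toℕ j)) ∎
      where
      e₀ : ∀ l → l ℤ.+ + 0 ≡ l
      e₀ = solve-∀
      e₁ : ∀ l k → + 1 ℤ.+ k ℤ.+ l ≡ + 1 ℤ.+ l ℤ.+ k
      e₁ = solve-∀
      e₂ : ∀ l k → l ℤ.+ (+ 1 ℤ.+ k) ≡ + 1 ℤ.+ l ℤ.+ k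
      e₂ = solve-∀
      product : ∀ i j → f (l i ℤ.+ + toℕ j) ≈ sumFin {N} (λ k → f (ℤ.suc (l i) ℤ.+ + toℕ k) * companion (a ∘ toℕ) k j)
      product i zero = trans (reflexive (≡.cong f (e₀ (l i)))) (trans (recurrence (l i))
        (sum-cong {N} (λ k → trans (*-comm _ _) (*-congʳ {a (toℕ k)} (reflexive (≡.cong f (e₁ (l i) (+ toℕ k))))))))
      product i (suc j) = sym (trans (sum-δʳ {N} (λ k → f (ℤ.suc (l i) ℤ.+ + toℕ k)) (inject₁ j))
        (reflexive (≡.cong f (≡.trans (≡.cong (λ k → ℤ.suc (l i) ℤ.+ + k) (Fin.toℕ-inject₁ j)) (≡.sym (e₂ (l i) (+ toℕ j)))))))

    det-shift : ∀ n (l : Fin N → ℤ) →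
      det (λ i j → f (l i ℤ.- + n ℤ.+ + toℕ j)) ≈ det (λ i j → f (l i ℤ.+ + toℕ j))
    det-shift zero    l = det-cong {N} (λ i j → reflexive (≡.cong f (≡.cong (ℤ._+ + toℕ j) (ℤ.+-identityʳ (l i)))))
    det-shift (suc n) l = begin
      det (λ i j → f (l i ℤ.- + suc n ℤ.+ + toℕ j))
        ≈⟨ det-suc (λ i → l i ℤ.- + suc n) ⟩
      det (λ i j → f (ℤ.suc (l i ℤ.- + suc n) ℤ.+ + toℕ j))
        ≈⟨ det-cong {N} (λ i j → reflexive (≡.cong f (≡.cong (ℤ._+ + toℕ j) (e (l i) (+ n))))) ⟩
      det (λ i j → f (l i ℤ.- + n ℤ.+ + toℕ j))
        ≈⟨ det-shift n l ⟩
      det (λ i j → f (l i ℤ.+ + toℕ j)) ∎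
      where
      e : ∀ l n → + 1 ℤ.+ (l ℤ.- (+ 1 ℤ.+ n)) ≡ l ℤ.- n
      e = solve-∀

    P Q : (ℕ → ℕ) → Matrix m
    P p i j = f (+ p (toℕ i) ℤ.- + toℕ i ℤ.+ + toℕ j)
    Q p i j = f (+ p (toℕ i) ℤ.- + toℕ i ℤ.- + toℕ j ℤ.- + 1)

    jacobiTrudi : (ℕ → ℕ) → Matrix N
    jacobiTrudi p i j = f (doubled m p (toℕ i) ℤ.- + toℕ i ℤ.+ + toℕ j)

    centred : (ℕ → ℕ) → ℕ → ℕ → Carrier
    centred p i j = f (doubled m p i ℤ.- + i ℤ.- + (p 0 ℕ.+ m) ℤ.+ + j)

    -- Rows (i, 2m-i) of the centred matrix are mirror images of one another under
    -- the exchange of the columns m+j and m-1-j, and its middle row is e_{2m}.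
    rowℕ columnℕ : Fin m ⊎ Fin m → ℕ
    rowℕ (inj₁ i) = toℕ i
    rowℕ (inj₂ i) = (m ℕ.+ m) ∸ toℕ i
    columnℕ (inj₁ j) = m ℕ.+ toℕ j
    columnℕ (inj₂ j) = m ∸ suc (toℕ j)

    rowℕ-< : ∀ s → rowℕ s ℕ.< N
    rowℕ-< (inj₁ i) = ℕ.s≤s (ℕ.≤-trans (ℕ.<⇒≤ (Fin.toℕ<n i)) (ℕ.m≤m+n m m))
    rowℕ-< (inj₂ i) = ℕ.s≤s (ℕ.m∸n≤m (m ℕ.+ m) (toℕ i))

    columnℕ-< : ∀ s → columnℕ s ℕ.< N
    columnℕ-< (inj₁ j) = ℕ.s≤s (ℕ.+-monoʳ-≤ m (ℕ.<⇒≤ (Fin.toℕ<n j)))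
    columnℕ-< (inj₂ j) = ℕ.s≤s (ℕ.≤-trans (ℕ.m∸n≤m m (suc (toℕ j))) (ℕ.m≤m+n m m))

    -- The middle row and the last column are brought to the front, where the 1 in which they meet
    -- can be split off by expansion along the first row; the rest is indexed by the two blocks.
    row column : Fin N → Fin N
    row zero       = fromℕ< {m} (ℕ.s≤s (ℕ.m≤m+n m m))
    row (suc i)    = fromℕ< (rowℕ-< (splitAt m i))
    column zero    = fromℕ< {m ℕ.+ m} ℕ.≤-refl
    column (suc j) = fromℕ< (columnℕ-< (splitAt m j))

    sign : Carrier
    sign = det {N} (δ ∘ row) * det {N} (δ ∘ column)

    f-negative : ∀ {r} k → k ℕ.< m ℕ.+ m → r ≡ ℤ.- (+ suc k) → f r ≈ 0#
    f-negative k k<2m r≡ = trans (reflexive (≡.cong f r≡)) (f₋≈0 k k<2m)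

    centred-middle-last : ∀ p → centred p m (m ℕ.+ m) ≈ 1#
    centred-middle-last p = trans (reflexive (≡.cong f (≡.trans
      (≡.cong (λ x → x ℤ.- + m ℤ.- + (p 0 ℕ.+ m) ℤ.+ + (m ℕ.+ m)) (doubled-middle m p)) (e (+ p 0) (+ m))))) f₀≈1
      where
      e : ∀ p₀ m → p₀ ℤ.- m ℤ.- (p₀ ℤ.+ m) ℤ.+ (m ℤ.+ m) ≡ + 0
      e = solve-∀

    centred-middle : ∀ p j → j ℕ.< m ℕ.+ m → centred p m j ≈ 0#
    centred-middle p j j<2m with ℕ.m≤n⇒∃[o]m+o≡n j<2m
    ... | d , j+1+d≡2m = f-negative d
      (ℕ.≤-trans (ℕ.s≤s (ℕ.m≤n+m d j)) (ℕ.≤-reflexive j+1+d≡2m))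
      (≡.trans (≡.cong (λ x → x ℤ.- + m ℤ.- + (p 0 ℕ.+ m) ℤ.+ + j) (doubled-middle m p))
        (≡.trans (e₁ (+ p 0) (+ m) (+ j)) (≡.trans (≡.cong (λ x → + j ℤ.- + x) (≡.sym j+1+d≡2m)) (e₂ (+ j) (+ d)))))
      where
      e₁ : ∀ p₀ m j → p₀ ℤ.- m ℤ.- (p₀ ℤ.+ m) ℤ.+ j ≡ j ℤ.- (m ℤ.+ m)
      e₁ = solve-∀
      e₂ : ∀ j d → j ℤ.- (+ 1 ℤ.+ j ℤ.+ d) ≡ ℤ.- (+ 1 ℤ.+ d)
      e₂ = solve-∀

    columnℕ-<2m : ∀ s → columnℕ s ℕ.< m ℕ.+ m
    columnℕ-<2m (inj₁ j) = ℕ.+-monoʳ-< m (Fin.toℕ<n j)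
    columnℕ-<2m (inj₂ j) = ℕ.<-≤-trans (ℕ.∸-monoʳ-< (ℕ.s≤s ℕ.z≤n) (Fin.toℕ<n j)) (ℕ.m≤m+n m m)

    -- In an upper row the index in column `c` is `p i - i - m + c`. In row `2m - i` it is
    -- `-p i + i - 3m + c`, which `reflect` turns into the upper index at column `2m - 1 - c`; this
    -- exchanges `m + j` and `m - 1 - j`.
    centred-blocks : ∀ p s t → centred p (rowℕ s) (columnℕ t) ≈ fromBlocks (P p) (Q p) (Q p) (P p) s t
    centred-blocks p (inj₁ i) (inj₁ j) = reflexive (≡.cong f (≡.trans
      (≡.cong (λ x → x ℤ.- + toℕ i ℤ.- + (p 0 ℕ.+ m) ℤ.+ + (m ℕ.+ toℕ j)) (doubled-top p (Fin.toℕ<n i)))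
      (e (+ p 0) (+ p (toℕ i)) (+ toℕ i) (+ m) (+ toℕ j))))
      where
      e : ∀ p₀ pᵢ i m j → p₀ ℤ.+ pᵢ ℤ.- i ℤ.- (p₀ ℤ.+ m) ℤ.+ (m ℤ.+ j) ≡ pᵢ ℤ.- i ℤ.+ j
      e = solve-∀
    centred-blocks p (inj₁ i) (inj₂ j) = reflexive (≡.cong f (≡.trans
      (≡.cong₂ (λ x y → x ℤ.- + toℕ i ℤ.- + (p 0 ℕ.+ m) ℤ.+ y) (doubled-top p (Fin.toℕ<n i)) (pos-∸ (Fin.toℕ<n j)))
      (e (+ p 0) (+ p (toℕ i)) (+ toℕ i) (+ m) (+ toℕ j))))
      where
      e : ∀ p₀ pᵢ i m j → p₀ ℤ.+ pᵢ ℤ.- i ℤ.- (p₀ ℤ.+ m) ℤ.+ (m ℤ.- (+ 1 ℤ.+ j)) ≡ pᵢ ℤ.- i ℤ.- j ℤ.- + 1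
      e = solve-∀
    centred-blocks p (inj₂ i) (inj₁ j) = trans (sym (reflect _)) (reflexive (≡.cong f (≡.trans
      (≡.cong₂ (λ x y → ℤ.- (+ N) ℤ.- (x ℤ.- y ℤ.- + (p 0 ℕ.+ m) ℤ.+ + (m ℕ.+ toℕ j)))
        (doubled-mirror p (Fin.toℕ<n i)) (pos-∸ (ℕ.≤-trans (ℕ.<⇒≤ (Fin.toℕ<n i)) (ℕ.m≤m+n m m))))
      (e (+ p 0) (+ p (toℕ i)) (+ toℕ i) (+ m) (+ toℕ j)))))
      where
      e : ∀ p₀ pᵢ i m j → ℤ.- (+ 1 ℤ.+ (m ℤ.+ m)) ℤ.- (p₀ ℤ.- pᵢ ℤ.- (m ℤ.+ m ℤ.- i) ℤ.- (p₀ ℤ.+ m) ℤ.+ (m ℤ.+ j)) ≡ pᵢ ℤ.- i ℤ.- j ℤ.- + 1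
      e = solve-∀
    centred-blocks p (inj₂ i) (inj₂ j) = trans (sym (reflect _)) (reflexive (≡.cong f (≡.trans
      (≡.cong₂ (λ x y → ℤ.- (+ N) ℤ.- (x ℤ.- + ((m ℕ.+ m) ∸ toℕ i) ℤ.- + (p 0 ℕ.+ m) ℤ.+ y))
        (doubled-mirror p (Fin.toℕ<n i)) (pos-∸ (Fin.toℕ<n j)))
      (≡.trans (≡.cong (λ y → ℤ.- (+ N) ℤ.- (+ p 0 ℤ.- + p (toℕ i) ℤ.- y ℤ.- + (p 0 ℕ.+ m) ℤ.+ (+ m ℤ.- + suc (toℕ j))))
          (pos-∸ (ℕ.≤-trans (ℕ.<⇒≤ (Fin.toℕ<n i)) (ℕ.m≤m+n m m))))
        (e (+ p 0) (+ p (toℕ i)) (+ toℕ i) (+ m) (+ toℕ j))))))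
      where
      e : ∀ p₀ pᵢ i m j → ℤ.- (+ 1 ℤ.+ (m ℤ.+ m)) ℤ.- (p₀ ℤ.- pᵢ ℤ.- (m ℤ.+ m ℤ.- i) ℤ.- (p₀ ℤ.+ m) ℤ.+ (m ℤ.- (+ 1 ℤ.+ j))) ≡ pᵢ ℤ.- i ℤ.+ j
      e = solve-∀

    E O : (ℕ → ℕ) → Carrier
    E p = det (λ i j → P p i j + Q p i j)
    O p = det (λ i j → P p i j - Q p i j)

    factorization-up-to-sign : ∀ p → sign * det (jacobiTrudi p) ≈ E p * O p
    factorization-up-to-sign p = begin
      sign * det (jacobiTrudi p)
        ≈⟨ *-congˡ (det-shift (p 0 ℕ.+ m) (λ i → doubled m p (toℕ i) ℤ.- + toℕ i)) ⟨
      sign * det {N} (λ i j → centred p (toℕ i) (toℕ j))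
        ≈⟨ *-assoc _ _ _ ⟩
      det {N} (δ ∘ row) * (det {N} (δ ∘ column) * det {N} (λ i j → centred p (toℕ i) (toℕ j)))
        ≈⟨ det-reindex {N} row column (λ i j → centred p (toℕ i) (toℕ j)) ⟨
      det {N} X
        ≈⟨ det-firstRow {m ℕ.+ m} X (λ j → trans
             (reflexive (≡.cong₂ (centred p) (Fin.toℕ-fromℕ< _) (Fin.toℕ-fromℕ< (columnℕ-< (splitAt m j)))))
             (centred-middle p _ (columnℕ-<2m (splitAt m j)))) ⟩
      X zero zero * det {m ℕ.+ m} (λ i j → X (suc i) (suc j))
        ≈⟨ *-cong (trans (reflexive (≡.cong₂ (centred p) (Fin.toℕ-fromℕ< _) (Fin.toℕ-fromℕ< _))) (centred-middle-last p))
             (det-cong {m ℕ.+ m} (λ i j → trans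
               (reflexive (≡.cong₂ (centred p) (Fin.toℕ-fromℕ< (rowℕ-< (splitAt m i))) (Fin.toℕ-fromℕ< (columnℕ-< (splitAt m j)))))
               (centred-blocks p (splitAt m i) (splitAt m j)))) ⟩
      1# * det (blocks (fromBlocks (P p) (Q p) (Q p) (P p)))
        ≈⟨ trans (*-identityˡ _) (det-symmetricBlocks m (P p) (Q p)) ⟩
      E p * O p ∎
      where
      X : Matrix N
      X i j = centred p (toℕ (row i)) (toℕ (column j))

    doubled-zero : ∀ k → doubled m (λ _ → 0) k ≡ + 0
    doubled-zero k with k <ᵇ m | k ≡ᵇ m
    ... | true  | _     = ≡.refl
    ... | false | true  = ≡.refl
    ... | false | false = ≡.refl

    f-diagonal : ∀ i → f (+ 0 ℤ.- + i ℤ.+ + i) ≈ 1#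
    f-diagonal i = trans (reflexive (≡.cong f (e (+ i)))) f₀≈1
      where
      e : ∀ i → + 0 ℤ.- i ℤ.+ i ≡ + 0
      e = solve-∀

    f-below : ∀ {i j} → j ℕ.< i → i ℕ.≤ m ℕ.+ m → f (+ 0 ℤ.- + i ℤ.+ + j) ≈ 0#
    f-below {i} {j} j<i i≤2m with ℕ.m≤n⇒∃[o]m+o≡n j<i
    ... | d , j+1+d≡i = f-negative d
      (ℕ.≤-trans (ℕ.≤-trans (ℕ.s≤s (ℕ.m≤n+m d j)) (ℕ.≤-reflexive j+1+d≡i)) i≤2m)
      (≡.trans (≡.cong (λ x → + 0 ℤ.- + x ℤ.+ + j) (≡.sym j+1+d≡i)) (e (+ j) (+ d)))
      where
      e : ∀ j d → + 0 ℤ.- (+ 1 ℤ.+ j ℤ.+ d) ℤ.+ j ≡ ℤ.- (+ 1 ℤ.+ d)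
      e = solve-∀

    Q-zero : ∀ i j → Q (λ _ → 0) i j ≈ 0#
    Q-zero i j = f-negative (toℕ i ℕ.+ toℕ j) (ℕ.+-mono-<-≤ (Fin.toℕ<n i) (ℕ.<⇒≤ (Fin.toℕ<n j))) (e (+ toℕ i) (+ toℕ j))
      where
      e : ∀ i j → + 0 ℤ.- i ℤ.- j ℤ.- + 1 ≡ ℤ.- (+ 1 ℤ.+ (i ℤ.+ j))
      e = solve-∀

    P-below : ∀ (i j : Fin m) → j Fin.< i → P (λ _ → 0) i j ≈ 0#
    P-below i j j<i = f-below j<i (ℕ.≤-trans (ℕ.<⇒≤ (Fin.toℕ<n i)) (ℕ.m≤m+n m m))

    -- For the empty partition all three determinants are unitriangular.
    sign≈1 : sign ≈ 1#
    sign≈1 = begin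
      sign
        ≈⟨ *-identityʳ _ ⟨
      sign * 1#
        ≈⟨ *-congˡ (det-unitriangular {N} (jacobiTrudi (λ _ → 0))
             (λ i → trans (atZero i i) (f-diagonal (toℕ i)))
             (λ i j j<i → trans (atZero i j) (f-below j<i (ℕ.≤-pred (Fin.toℕ<n i))))) ⟨
      sign * det (jacobiTrudi (λ _ → 0))
        ≈⟨ factorization-up-to-sign (λ _ → 0) ⟩
      E (λ _ → 0) * O (λ _ → 0)
        ≈⟨ *-cong
             (det-unitriangular {m} _
               (λ i → trans (+-cong (f-diagonal (toℕ i)) (Q-zero i i)) (+-identityʳ _))
               (λ i j j<i → trans (+-cong (P-below i j j<i) (Q-zero i j)) (+-identityʳ _)))
             (det-unitriangular {m} _
               (λ i → trans (+-cong (f-diagonal (toℕ i)) (-‿cong (Q-zero i i))) (trans (+-congˡ -0#≈0#) (+-identityʳ _)))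
               (λ i j j<i → trans (+-cong (P-below i j j<i) (-‿cong (Q-zero i j))) (trans (+-congˡ -0#≈0#) (+-identityʳ _)))) ⟩
      1# * 1#
        ≈⟨ *-identityˡ 1# ⟩
      1# ∎
      where
      atZero : ∀ i j → jacobiTrudi (λ _ → 0) i j ≈ f (+ 0 ℤ.- + toℕ i ℤ.+ + toℕ j)
      atZero i j = reflexive (≡.cong (λ x → f (x ℤ.- + toℕ i ℤ.+ + toℕ j)) (doubled-zero (toℕ i)))

    factorization : ∀ p → det (jacobiTrudi p) ≈ E p * O p
    factorization p = trans (sym (trans (*-congʳ sign≈1) (*-identityˡ _))) (factorization-up-to-sign p)

-- Symmetry of h and rearrangement of the rotated alphabets

module Alphabets {c ℓ} (F : Field c ℓ) where
  open Field F hiding (zero) renaming (refl to ≈-refl; trans to ≈-trans)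
  open FieldDefs F
  open IntegerCoefficients F
  open Recurrence F
  open Relation.Binary.Reasoning.Setoid setoid
  open Data.List.Relation.Binary.Permutation.Setoid setoid
    using (_↭_; refl; prep; swap; trans; ↭-refl; ↭-sym; ↭-trans; ↭-prep; ↭-swap; ↭-reflexive)
  open Data.List.Relation.Binary.Permutation.Setoid.Properties setoid
    using (↭-shift; ++⁺; ++⁺ˡ; ++-comm; shifts; ++-commutativeMonoid)
    renaming (shift to ↭-shift-≈)
  open Algebra.Properties.CommutativeSemigroup (CommutativeMonoid.commutativeSemigroup ++-commutativeMonoid)
    using (interchange)

  hN-∷-cong : ∀ {x y X Y} → x ≈ y → (∀ k → hN k X ≈ hN k Y) → ∀ k → hN k (x ∷ X) ≈ hN k (y ∷ Y)
  hN-∷-cong x≈y X≈Y zero    = ≈-refl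
  hN-∷-cong x≈y X≈Y (suc k) = +-cong (*-cong x≈y (hN-∷-cong x≈y X≈Y k)) (X≈Y (suc k))

  -- The recursion of `hN` singles out the first letter, so symmetry needs proof. Swapping one
  -- degree lower exposes both letters, and the two expansions then differ only by terms two degrees
  -- lower, again related by induction.
  hN-swap : ∀ x y Z k → hN k (x ∷ y ∷ Z) ≈ hN k (y ∷ x ∷ Z)
  hN-swap x y Z zero          = ≈-refl
  hN-swap x y Z (suc zero)    = solve 3 (λ x y z → x :* con (+ 1) :+ (y :* con (+ 1) :+ z) := y :* con (+ 1) :+ (x :* con (+ 1) :+ z)) ≈-refl x y _
  hN-swap x y Z (suc (suc k)) = begin
    x * hN (suc k) (x ∷ y ∷ Z) + (y * hN (suc k) (y ∷ Z) + hN (suc (suc k)) Z)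
      ≈⟨ +-congʳ (*-congˡ (hN-swap x y Z (suc k))) ⟩
    x * (y * hN k (y ∷ x ∷ Z) + hN (suc k) (x ∷ Z)) + (y * hN (suc k) (y ∷ Z) + hN (suc (suc k)) Z)
      ≈⟨ solve 6 (λ x y p q r s → x :* (y :* p :+ q) :+ (y :* r :+ s) := y :* (x :* p :+ r) :+ (x :* q :+ s)) ≈-refl x y _ _ _ _ ⟩
    y * (x * hN k (y ∷ x ∷ Z) + hN (suc k) (y ∷ Z)) + (x * hN (suc k) (x ∷ Z) + hN (suc (suc k)) Z)
      ≈⟨ +-congʳ (*-congˡ (+-congʳ (*-congˡ (hN-swap x y Z k)))) ⟨
    y * hN (suc k) (x ∷ y ∷ Z) + (x * hN (suc k) (x ∷ Z) + hN (suc (suc k)) Z)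
      ≈⟨ +-congʳ (*-congˡ (hN-swap x y Z (suc k))) ⟩
    y * hN (suc k) (y ∷ x ∷ Z) + (x * hN (suc k) (x ∷ Z) + hN (suc (suc k)) Z) ∎

  -- Permutations are taken up to `_≈_`, because inverses of rotated letters are known only up to
  -- that relation.
  hN-↭ : ∀ {X Y} → X ↭ Y → ∀ k → hN k X ≈ hN k Y
  hN-↭ (refl X≋Y)     k = pointwise X≋Y k
    where
    pointwise : ∀ {X Y} → Pointwise _≈_ X Y → ∀ k → hN k X ≈ hN k Y
    pointwise []          k = ≈-refl
    pointwise (x≈y ∷ X≋Y) k = hN-∷-cong x≈y (pointwise X≋Y) k
  hN-↭ (prep x≈y p)   k = hN-∷-cong x≈y (hN-↭ p) k
  hN-↭ {x ∷ y ∷ X} (swap x≈x′ y≈y′ p) k =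
    ≈-trans (hN-swap x y X k) (hN-∷-cong y≈y′ (hN-∷-cong x≈x′ (hN-↭ p)) k)
  hN-↭ (trans p q)    k = ≈-trans (hN-↭ p k) (hN-↭ q k)

  h-↭ : ∀ {X Y} → X ↭ Y → ∀ r → h r X ≈ h r Y
  h-↭ p (+ k)    = hN-↭ p k
  h-↭ p -[1+ k ] = ≈-refl

  unit-inverse : ∀ {a b} → a * b ≈ 1# → a * a ⁻¹ ≈ 1#
  unit-inverse {a} {b} ab≈1 = inverseʳ a λ a≈0 → 1≉0 (begin
    1#      ≈⟨ ab≈1 ⟨
    a * b   ≈⟨ *-congʳ a≈0 ⟩
    0# * b  ≈⟨ zeroˡ b ⟩
    0#      ∎)

  -- `Field` does not postulate that `_⁻¹` respects `_≈_`; every identity between inverses is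
  -- obtained through this uniqueness.
  inverse-unique : ∀ {a b} → a * b ≈ 1# → a ⁻¹ ≈ b
  inverse-unique {a} {b} ab≈1 = begin
    a ⁻¹             ≈⟨ *-identityʳ _ ⟨
    a ⁻¹ * 1#        ≈⟨ *-congˡ ab≈1 ⟨
    a ⁻¹ * (a * b)   ≈⟨ solve 3 (λ x a b → x :* (a :* b) := (a :* x) :* b) ≈-refl _ _ _ ⟩
    (a * a ⁻¹) * b   ≈⟨ *-congʳ (unit-inverse ab≈1) ⟩
    1# * b           ≈⟨ *-identityˡ b ⟩
    b                ∎

  Invertible : Carrier → Set ℓ
  Invertible z = z * z ⁻¹ ≈ 1#

  withInv-balanced : ∀ W → 1# ∷ withInv W ↭ balanced W
  withInv-balanced []      = ↭-refl
  withInv-balanced (z ∷ W) = ↭-trans (↭-swap 1# z ↭-refl) (↭-prep z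
    (↭-trans (↭-shift (1# ∷ W) (map _⁻¹ W)) (↭-prep (z ⁻¹) (withInv-balanced W))))

  -- The letter 1 and its inverse contribute two ones; one belongs to `balanced W`, the other is
  -- later removed by column differences.
  withInv-∷ʳ1 : ∀ W → withInv (W ++ 1# ∷ []) ↭ 1# ∷ balanced W
  withInv-∷ʳ1 W = ↭-trans
    (↭-reflexive (≡.trans (≡.cong ((W ++ 1# ∷ []) ++_) (List.map-++ _⁻¹ W (1# ∷ [])))
      (≡.sym (List.++-assoc (W ++ 1# ∷ []) (map _⁻¹ W) (1# ⁻¹ ∷ [])))))
    (↭-trans (↭-shift-≈ (inverse-unique (*-identityˡ 1#)) ((W ++ 1# ∷ []) ++ map _⁻¹ W) [])
    (↭-prep 1# (↭-trans (↭-reflexive (≡.trans (List.++-identityʳ _) (List.++-assoc W (1# ∷ []) (map _⁻¹ W))))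
      (↭-trans (↭-shift W (map _⁻¹ W)) (withInv-balanced W)))))

  pow-+ : ∀ x a b → pow x (a ℕ.+ b) ≈ pow x a * pow x b
  pow-+ x zero    b = sym (*-identityˡ _)
  pow-+ x (suc a) b = ≈-trans (*-congˡ (pow-+ x a b)) (sym (*-assoc x _ _))

  -- An arbitrary list of exponents allows induction on the list and lets inversion act on the
  -- exponents.
  rotationsBy : List ℕ → Carrier → List Carrier → List Carrier
  rotationsBy J ω Y = concat (map (λ j → map (λ y → pow ω j * y) Y) J)

  rotationsBy-++ : ∀ J ω Y Z → rotationsBy J ω (Y ++ Z) ↭ rotationsBy J ω Y ++ rotationsBy J ω Z
  rotationsBy-++ []      ω Y Z = ↭-refl
  rotationsBy-++ (j ∷ J) ω Y Z = ↭-trans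
    (++⁺ (↭-reflexive (List.map-++ (λ y → pow ω j * y) Y Z)) (rotationsBy-++ J ω Y Z))
    (interchange (map (λ y → pow ω j * y) Y) _ (rotationsBy J ω Y) _)

  rotationsBy-↭ : ∀ {J J′} ω Y → J ℕPerm.↭ J′ → rotationsBy J ω Y ↭ rotationsBy J′ ω Y
  rotationsBy-↭ ω Y ℕPerm.refl         = ↭-refl
  rotationsBy-↭ ω Y (ℕPerm.prep j p)   = ++⁺ˡ _ (rotationsBy-↭ ω Y p)
  rotationsBy-↭ ω Y (ℕPerm.swap i j p) = ↭-trans
    (++⁺ˡ (map (λ y → pow ω i * y) Y) (++⁺ˡ (map (λ y → pow ω j * y) Y) (rotationsBy-↭ ω Y p)))
    (shifts (map (λ y → pow ω i * y) Y) (map (λ y → pow ω j * y) Y))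
  rotationsBy-↭ ω Y (ℕPerm.trans p q)  = ↭-trans (rotationsBy-↭ ω Y p) (rotationsBy-↭ ω Y q)

  product-of-inverses : ∀ {a a′ y} → a * a′ ≈ 1# → Invertible y → (a * y) * (a′ * y ⁻¹) ≈ 1#
  product-of-inverses {a} {a′} {y} aa′≈1 yy⁻¹≈1 = begin
    (a * y) * (a′ * y ⁻¹)  ≈⟨ solve 4 (λ a y a′ y′ → (a :* y) :* (a′ :* y′) := (a :* a′) :* (y :* y′)) ≈-refl _ _ _ _ ⟩
    (a * a′) * (y * y ⁻¹)  ≈⟨ *-cong aa′≈1 yy⁻¹≈1 ⟩
    1# * 1#                ≈⟨ *-identityˡ 1# ⟩
    1#                     ∎

  rotationsBy-inverse : ∀ J ω Y (ν : ℕ → ℕ) → All (λ j → pow ω j * pow ω (ν j) ≈ 1#) J → All Invertible Y →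
    map _⁻¹ (rotationsBy J ω Y) ↭ rotationsBy (map ν J) ω (map _⁻¹ Y)
  rotationsBy-inverse []      ω Y ν []          inv = ↭-refl
  rotationsBy-inverse (j ∷ J) ω Y ν (ωj ∷ ωJ) inv = ↭-trans
    (↭-reflexive (List.map-++ _⁻¹ (map (λ y → pow ω j * y) Y) (rotationsBy J ω Y)))
    (++⁺ (refl (one Y inv)) (rotationsBy-inverse J ω Y ν ωJ inv))
    where
    one : ∀ Y → All Invertible Y →
          Pointwise _≈_ (map _⁻¹ (map (λ y → pow ω j * y) Y)) (map (λ y → pow ω (ν j) * y) (map _⁻¹ Y))
    one []      []        = []
    one (y ∷ Y) (yi ∷ inv) = inverse-unique (product-of-inverses ωj yi) ∷ one Y inv

  rotationsBy-invertible : ∀ J ω Y (ν : ℕ → ℕ) → All (λ j → pow ω j * pow ω (ν j) ≈ 1#) J → All Invertible Y →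
    All Invertible (rotationsBy J ω Y)
  rotationsBy-invertible []      ω Y ν []        inv = []
  rotationsBy-invertible (j ∷ J) ω Y ν (ωj ∷ ωJ) inv =
    All.++⁺ (one Y inv) (rotationsBy-invertible J ω Y ν ωJ inv)
    where
    one : ∀ Y → All Invertible Y → All Invertible (map (λ y → pow ω j * y) Y)
    one []      []         = []
    one (y ∷ Y) (yi ∷ inv) = unit-inverse (product-of-inverses ωj yi) ∷ one Y inv

  length-rotationsBy : ∀ J ω Y → length (rotationsBy J ω Y) ≡ length J ℕ.* length Y
  length-rotationsBy []      ω Y = ≡.refl
  length-rotationsBy (j ∷ J) ω Y = ≡.trans (List.length-++ (map (λ y → pow ω j * y) Y))
    (≡.cong₂ ℕ._+_ (List.length-map _ Y) (length-rotationsBy J ω Y))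

  module _ (t : ℕ) (ω : Carrier) (ωᵗ≈1 : pow ω t ≈ 1#) where

    -- The inverse exponent of `j` is `t ∸ j`, so that 0 goes to `t` and not to 0; the discrepancy
    -- is repaired in `rotations-reverse`.
    opposite-powers : All (λ j → pow ω j * pow ω (t ∸ j) ≈ 1#) (upTo t)
    opposite-powers = All.applyUpTo⁺₁ id t λ {j} j<t → ≈-trans (sym (pow-+ ω j (t ∸ j)))
      (≈-trans (reflexive (≡.cong (pow ω) (ℕ.m+[n∸m]≡n (ℕ.<⇒≤ j<t)))) ωᵗ≈1)

    length-rotations : ∀ Y → length (rotations t ω Y) ≡ t ℕ.* length Y
    length-rotations Y = ≡.trans (length-rotationsBy (upTo t) ω Y) (≡.cong (ℕ._* length Y) (List.length-upTo t))

    rotations-invertible : ∀ Y → All Invertible Y → All Invertible (rotations t ω Y)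
    rotations-invertible Y = rotationsBy-invertible (upTo t) ω Y (t ∸_) opposite-powers

    -- The exponents are `t, t - 1, ..., 1`. The first may be replaced by 0 since the `t`-th power
    -- of `ω` is 1, and the others are a reversal of `1, ..., t - 1`.
    rotations-reverse : ∀ Y → rotationsBy (map (t ∸_) (upTo t)) ω Y ↭ rotations t ω Y
    rotations-reverse Y = ↭-trans (↭-reflexive (≡.cong (λ J → rotationsBy J ω Y) (List.map-upTo (t ∸_) t)))
      (cyclic t ωᵗ≈1)
      where
      descending : ∀ n → applyUpTo (n ∸_) n ≡ applyDownFrom suc n
      descending zero    = ≡.refl
      descending (suc n) = ≡.cong (suc n ∷_) (descending n)
      same : ∀ {a b} → a ≈ b → ∀ Y → Pointwise _≈_ (map (λ y → a * y) Y) (map (λ y → b * y) Y)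
      same a≈b []      = []
      same a≈b (y ∷ Y) = *-congʳ a≈b ∷ same a≈b Y
      cyclic : ∀ t → pow ω t ≈ 1# → rotationsBy (applyUpTo (t ∸_) t) ω Y ↭ rotationsBy (upTo t) ω Y
      cyclic zero    _    = ↭-refl
      cyclic (suc t) ωᵗ≈1 = ++⁺ (refl (same ωᵗ≈1 Y)) (rotationsBy-↭ ω Y (ℕPerm.↭-trans
        (ℕPerm.↭-reflexive (≡.trans (descending t) (≡.sym (List.reverse-applyUpTo suc t))))
        (ℕPerm.↭-reverse (applyUpTo suc t))))

    rotations-withInv : ∀ Y → All Invertible Y →
      rotations t ω (withInv Y) ++ 1# ∷ [] ↭ balanced (rotations t ω Y)
    rotations-withInv Y inv = ↭-trans (++-comm (rotations t ω (withInv Y)) (1# ∷ []))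
      (↭-trans (↭-prep 1# (↭-trans (rotationsBy-++ (upTo t) ω Y (map _⁻¹ Y))
        (++⁺ˡ (rotations t ω Y) (↭-trans (↭-sym (rotations-reverse (map _⁻¹ Y)))
          (↭-sym (rotationsBy-inverse (upTo t) ω Y (t ∸_) opposite-powers inv))))))
      (withInv-balanced (rotations t ω Y)))

-- The recursion of `part` runs in a local function that also carries the original arguments;
-- these are unused, so conversion ignores them and part (a ∷ b ∷ as) (suc k) unfolds to
-- part (b ∷ as) k.
part-lookup : ∀ {m} (μ : Vec ℕ m) i → part μ (toℕ i) ≡ lookup μ i
part-lookup (a ∷ as)     zero    = ≡.refl
part-lookup (a ∷ b ∷ as) (suc i) = part-lookup (b ∷ as) i

part-beyond : ∀ {m} (μ : Vec ℕ m) {k} → m ℕ.≤ k → part μ k ≡ 0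
part-beyond []           _             = ≡.refl
part-beyond (a ∷ [])     (ℕ.s≤s _)     = ≡.refl
part-beyond (a ∷ b ∷ as) (ℕ.s≤s m≤k)   = part-beyond (b ∷ as) m≤k

part-≤-first : ∀ {m} (μ : Vec ℕ m) → IsPartition μ → ∀ k → part μ k ℕ.≤ part μ 0
part-≤-first {zero}  []       _    k = ℕ.≤-refl
part-≤-first {suc m} (a ∷ as) part↘ k with k ℕ.<? suc m
... | no  k≮m = ℕ.≤-trans (ℕ.≤-reflexive (part-beyond (a ∷ as) (ℕ.≮⇒≥ k≮m))) ℕ.z≤n
... | yes k<m = ≡.subst (λ k → part (a ∷ as) k ℕ.≤ a) (Fin.toℕ-fromℕ< k<m)
  (ℕ.≤-trans (ℕ.≤-reflexive (part-lookup (a ∷ as) (fromℕ< k<m))) (part↘ zero (fromℕ< k<m) ℕ.z≤n))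

-- This keeps all indices of the Jacobi-Trudi matrix above `-N`, where `hExt` and `h` agree.
doubled-nonneg : ∀ m p → (∀ k → p k ℕ.≤ p 0) → ∀ k → ∃ λ d → doubled m p k ≡ + d
doubled-nonneg m p p≤p₀ k with k <ᵇ m | k ≡ᵇ m
... | true  | _     = _ , ≡.refl
... | false | true  = _ , ≡.refl
... | false | false = _ , ≡.sym (pos-∸ (p≤p₀ _))

-- Symplectic and odd orthogonal characters as det(P - Q) and det(P + Q)

module Characters {c ℓ} (F : Field c ℓ) where
  open Field F hiding (zero)
  open FieldDefs F
  open IntegerCoefficients F
  open Determinants F
  open StructuredDeterminants F
  open Recurrence F
  open Factorization F
  open Alphabets F
  open Algebra.Properties.Ring ring
  open Relation.Binary.Reasoning.Setoid setoid

  h-difference : ∀ Z r → h r Z ≈ h r (1# ∷ Z) - h (r ℤ.- + 1) (1# ∷ Z)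
  h-difference Z r = begin
    h r Z
      ≈⟨ solve 2 (λ x y → y := con (+ 1) :* x :+ y :- x) refl (h (r ℤ.- + 1) (1# ∷ Z)) (h r Z) ⟩
    1# * h (r ℤ.- + 1) (1# ∷ Z) + h r Z - h (r ℤ.- + 1) (1# ∷ Z)
      ≈⟨ +-congʳ (≡.subst (λ s → h s (1# ∷ Z) ≈ 1# * h (r ℤ.- + 1) (1# ∷ Z) + h s Z) (e r) (h-suc (r ℤ.- + 1) 1# Z)) ⟨
    h r (1# ∷ Z) - h (r ℤ.- + 1) (1# ∷ Z) ∎
    where
    e : ∀ r → + 1 ℤ.+ (r ℤ.- + 1) ≡ r
    e = solve-∀

  -- With `g k = H (a + k - 1) - H (a - k)` the entries are `g (j + 1) - g j`. This `g` is odd under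
  -- `k ↦ 1 - k`, so `g 0 = - g 1`: the case `s = -1` of the column differences, whose factor is 2.
  -- An empty matrix has no first column to yield that factor.
  det-sp : ∀ {n} → 1 ℕ.≤ n → (a : Fin n → ℤ) → ∀ Z →
    det (λ i j → h (a i ℤ.+ + toℕ j) Z + h (a i ℤ.- + toℕ j) Z)
      ≈ (1# + 1#) * det (λ i j → h (a i ℤ.+ + toℕ j) (1# ∷ Z) - h (a i ℤ.- + toℕ j ℤ.- + 1) (1# ∷ Z))
  det-sp {suc n} _ a Z = begin
    det (λ i j → h (a i ℤ.+ + toℕ j) Z + h (a i ℤ.- + toℕ j) Z)
      ≈⟨ det-cong {suc n} (λ i j → entry (a i) (toℕ j)) ⟩
    det (λ i j → g i (suc (toℕ j)) - g i (toℕ j))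
      ≈⟨ det-columnDifferences {n} (- 1#) g (λ i → first (a i)) ⟩
    (1# - - 1#) * det (λ i j → g i (suc (toℕ j)))
      ≈⟨ *-cong (+-congˡ (-‿involutive 1#))
           (det-cong {suc n} (λ i j → reflexive (≡.cong₂ (λ r s → H r - H s) (e₁ (a i) (+ toℕ j)) (e₂ (a i) (+ toℕ j))))) ⟩
    (1# + 1#) * det (λ i j → H (a i ℤ.+ + toℕ j) - H (a i ℤ.- + toℕ j ℤ.- + 1)) ∎
    where
    H : ℤ → Carrier
    H r = h r (1# ∷ Z)
    g′ : ℤ → ℕ → Carrier
    g′ a k = H (a ℤ.+ + k ℤ.- + 1) - H (a ℤ.- + k)
    g : Fin (suc n) → ℕ → Carrier
    g i = g′ (a i)
    e₁ : ∀ a j → a ℤ.+ (+ 1 ℤ.+ j) ℤ.- + 1 ≡ a ℤ.+ j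
    e₁ = solve-∀
    e₂ : ∀ a j → a ℤ.- (+ 1 ℤ.+ j) ≡ a ℤ.- j ℤ.- + 1
    e₂ = solve-∀
    e₃ : ∀ a → a ℤ.+ + 0 ℤ.- + 1 ≡ a ℤ.- + 1
    e₃ = solve-∀
    e₄ : ∀ a → a ℤ.- + 0 ≡ a ℤ.+ + 1 ℤ.- + 1
    e₄ = solve-∀
    first : ∀ a → g′ a 0 ≈ - 1# * g′ a 1
    first a = trans (reflexive (≡.cong₂ (λ r s → H r - H s) (e₃ a) (e₄ a)))
      (solve 2 (λ x y → x :- y := con -[1+ 0 ] :* (y :- x)) refl _ _)
    entry : ∀ a k → h (a ℤ.+ + k) Z + h (a ℤ.- + k) Z ≈ g′ a (suc k) - g′ a k
    entry a k = begin
      h (a ℤ.+ + k) Z + h (a ℤ.- + k) Z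
        ≈⟨ +-cong (h-difference Z (a ℤ.+ + k)) (h-difference Z (a ℤ.- + k)) ⟩
      (H (a ℤ.+ + k) - H (a ℤ.+ + k ℤ.- + 1)) + (H (a ℤ.- + k) - H (a ℤ.- + k ℤ.- + 1))
        ≈⟨ solve 4 (λ x y u v → (x :- y) :+ (u :- v) := (x :- v) :- (y :- u)) refl _ _ _ _ ⟩
      (H (a ℤ.+ + k) - H (a ℤ.- + k ℤ.- + 1)) - g′ a k
        ≡⟨ ≡.cong₂ (λ r s → (H r - H s) - g′ a k) (e₁ a (+ k)) (e₂ a (+ k)) ⟨
      g′ a (suc k) - g′ a k ∎

  -- Here `g k = K (a + k - 1) - K (a - k - 1)` vanishes at 0, so `s = 0` and no factor appears. The
  -- differences are read from right to left, removing a letter 1.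
  det-oe : ∀ {n} (a : Fin (suc n) → ℤ) Z →
    det (λ i j → h (a i ℤ.+ + toℕ j) (1# ∷ Z) - h (a i ℤ.- + toℕ j ℤ.- + 2) (1# ∷ Z))
      ≈ det (λ i j → h (a i ℤ.+ + toℕ j) Z + h (a i ℤ.- + toℕ j ℤ.- + 1) Z)
  det-oe {n} a Z = begin
    det (λ i j → K (a i ℤ.+ + toℕ j) - K (a i ℤ.- + toℕ j ℤ.- + 2))
      ≈⟨ det-cong {suc n} (λ i j → reflexive (≡.cong₂ (λ r s → K r - K s) (e₁ (a i) (+ toℕ j)) (e₂ (a i) (+ toℕ j)))) ⟩
    det (λ i j → g i (suc (toℕ j)))
      ≈⟨ trans (*-congʳ (trans (+-congˡ -0#≈0#) (+-identityʳ 1#))) (*-identityˡ _) ⟨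
    (1# - 0#) * det (λ i j → g i (suc (toℕ j)))
      ≈⟨ det-columnDifferences {n} 0# g (λ i → first (a i)) ⟨
    det (λ i j → g i (suc (toℕ j)) - g i (toℕ j))
      ≈⟨ det-cong {suc n} (λ i j → entry (a i) (toℕ j)) ⟨
    det (λ i j → h (a i ℤ.+ + toℕ j) Z + h (a i ℤ.- + toℕ j ℤ.- + 1) Z) ∎
    where
    K : ℤ → Carrier
    K r = h r (1# ∷ Z)
    g′ : ℤ → ℕ → Carrier
    g′ a k = K (a ℤ.+ + k ℤ.- + 1) - K (a ℤ.- + k ℤ.- + 1)
    g : Fin (suc n) → ℕ → Carrier
    g i = g′ (a i)
    e₁ : ∀ a j → a ℤ.+ j ≡ a ℤ.+ (+ 1 ℤ.+ j) ℤ.- + 1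
    e₁ = solve-∀
    e₂ : ∀ a j → a ℤ.- j ℤ.- + 2 ≡ a ℤ.- (+ 1 ℤ.+ j) ℤ.- + 1
    e₂ = solve-∀
    e₃ : ∀ a → a ℤ.+ + 0 ℤ.- + 1 ≡ a ℤ.- + 0 ℤ.- + 1
    e₃ = solve-∀
    e₄ : ∀ a j → a ℤ.- j ℤ.- + 1 ℤ.- + 1 ≡ a ℤ.- (+ 1 ℤ.+ j) ℤ.- + 1
    e₄ = solve-∀
    first : ∀ a → g′ a 0 ≈ 0# * g′ a 1
    first a = trans (+-congʳ (reflexive (≡.cong K (e₃ a)))) (trans (-‿inverseʳ _) (sym (zeroˡ _)))
    entry : ∀ a k → h (a ℤ.+ + k) Z + h (a ℤ.- + k ℤ.- + 1) Z ≈ g′ a (suc k) - g′ a k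
    entry a k = begin
      h (a ℤ.+ + k) Z + h (a ℤ.- + k ℤ.- + 1) Z
        ≈⟨ +-cong (h-difference Z (a ℤ.+ + k)) (h-difference Z (a ℤ.- + k ℤ.- + 1)) ⟩
      (K (a ℤ.+ + k) - K (a ℤ.+ + k ℤ.- + 1)) + (K (a ℤ.- + k ℤ.- + 1) - K (a ℤ.- + k ℤ.- + 1 ℤ.- + 1))
        ≈⟨ solve 4 (λ x y u v → (x :- y) :+ (u :- v) := (x :- v) :- (y :- u)) refl _ _ _ _ ⟩
      (K (a ℤ.+ + k) - K (a ℤ.- + k ℤ.- + 1 ℤ.- + 1)) - g′ a k
        ≡⟨ ≡.cong₂ (λ r s → (K r - K s) - g′ a k) (e₁ a (+ k)) (e₄ a (+ k)) ⟩
      g′ a (suc k) - g′ a k ∎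

  -- The sizes `m + 1` and `2 * m + 1` are not successors by computation. With entries given on
  -- natural numbers, a change of size leaves the formula for the entries as it is.
  det-resize : ∀ {m n} → m ≡ n → (g : ℕ → ℕ → Carrier) →
    det {m} (λ i j → g (toℕ i) (toℕ j)) ≡ det {n} (λ i j → g (toℕ i) (toℕ j))
  det-resize ≡.refl g = ≡.refl

  det-lastRow : ∀ m (g : ℕ → ℕ → Carrier) → (∀ j → j ℕ.< m → g m j ≈ 0#) →
    det {m ℕ.+ 1} (λ i j → g (toℕ i) (toℕ j)) ≈ det {m} (λ i j → g (toℕ i) (toℕ j)) * g m m
  det-lastRow m g gₘ≈0 = begin
    det {m ℕ.+ 1} (λ i j → g (toℕ i) (toℕ j))
      ≈⟨ det-cong {m ℕ.+ 1} (λ i j → reflexive (≡.cong₂ g (value-splitAt m i) (value-splitAt m j))) ⟩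
    det {m ℕ.+ 1} (blocks (λ s t → g (value s) (value t)))
      ≈⟨ det-upperBlocks m (λ s t → g (value s) (value t)) (λ _ j → gₘ≈0 (toℕ j) (Fin.toℕ<n j)) ⟩
    det {m} (λ i j → g (toℕ i) (toℕ j)) * det {1} (λ _ _ → g m m)
      ≈⟨ *-congˡ (solve 1 (λ x → con (+ 1) :* (x :* con (+ 1)) :+ con (+ 0) := x) refl _) ⟩
    det {m} (λ i j → g (toℕ i) (toℕ j)) * g m m ∎
    where
    value : ∀ {m} → Fin m ⊎ Fin 1 → ℕ
    value     (inj₁ i) = toℕ i
    value {m} (inj₂ _) = m
    value-splitAt : ∀ m (i : Fin (m ℕ.+ 1)) → toℕ i ≡ value (splitAt m i)
    value-splitAt zero    zero    = ≡.refl
    value-splitAt (suc m) zero    = ≡.refl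
    value-splitAt (suc m) (suc i) = ≡.trans (≡.cong suc (value-splitAt m i)) (value-suc (splitAt m i))
      where
      value-suc : ∀ {m} (s : Fin m ⊎ Fin 1) → suc (value s) ≡ value (Sum.map suc id s)
      value-suc (inj₁ _) = ≡.refl
      value-suc (inj₂ _) = ≡.refl

  module _ (W : List Carrier) where

    m : ℕ
    m = length W

    H : ℤ → Carrier
    H r = h r (balanced W)

    m*2≡m+m : m ℕ.* 2 ≡ m ℕ.+ m
    m*2≡m+m = ≡.trans (ℕ.*-comm m 2) (≡.cong (m ℕ.+_) (ℕ.+-identityʳ m))

    -- Writing `r` as `d - s` with `s ≤ 2m` encodes `r > -N`; the mirrored index is then visibly
    -- negative.
    hExt-near : ∀ {r} d s → s ℕ.≤ m ℕ.+ m → r ≡ + d ℤ.- + s → hExt W r ≈ H r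
    hExt-near {r} d s s≤2m r≡d-s with ℕ.m≤n⇒∃[o]m+o≡n s≤2m
    ... | o , s+o≡2m = trans (+-congˡ (reflexive (≡.cong H negative))) (+-identityʳ _)
      where
      e : ∀ d s o → ℤ.- (+ 1 ℤ.+ (s ℤ.+ o)) ℤ.- (d ℤ.- s) ≡ ℤ.- (+ 1 ℤ.+ (d ℤ.+ o))
      e = solve-∀
      negative : ℤ.- (+ size W) ℤ.- r ≡ -[1+ d ℕ.+ o ]
      negative = ≡.trans (≡.cong₂ (λ M r → ℤ.- (+ suc M) ℤ.- r) (≡.trans m*2≡m+m (≡.sym s+o≡2m)) r≡d-s) (e (+ d) (+ s) (+ o))

    sums differences : (ℕ → ℕ) → Matrix m
    sums p i j        = H (+ p (toℕ i) ℤ.- + toℕ i ℤ.+ + toℕ j) + H (+ p (toℕ i) ℤ.- + toℕ i ℤ.- + toℕ j ℤ.- + 1)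
    differences p i j = H (+ p (toℕ i) ℤ.- + toℕ i ℤ.+ + toℕ j) - H (+ p (toℕ i) ℤ.- + toℕ i ℤ.- + toℕ j ℤ.- + 1)

    h-factorization : All Invertible W → ∀ p → (∀ k → p k ℕ.≤ p 0) →
      det {2 ℕ.* m ℕ.+ 1} (λ i j → H (doubled m p (toℕ i) ℤ.- + toℕ i ℤ.+ + toℕ j))
        ≈ det (sums p)
        * det (differences p)
    h-factorization inv p p≤p₀ = begin
      det {2 ℕ.* m ℕ.+ 1} (λ i j → H (doubled m p (toℕ i) ℤ.- + toℕ i ℤ.+ + toℕ j))
        ≡⟨ det-resize 2m+1≡N (λ i j → H (doubled m p i ℤ.- + i ℤ.+ + j)) ⟩
      det {suc (m ℕ.+ m)} (λ i j → H (doubled m p (toℕ i) ℤ.- + toℕ i ℤ.+ + toℕ j))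
        ≈⟨ det-cong {suc (m ℕ.+ m)} (λ i j → jt (toℕ i) (toℕ j) (ℕ.≤-pred (Fin.toℕ<n i))) ⟨
      det {suc (m ℕ.+ m)} (λ i j → hExt W (doubled m p (toℕ i) ℤ.- + toℕ i ℤ.+ + toℕ j))
        ≈⟨ Symmetric.factorization m (hExt W) (charPoly W ∘ suc) monic recurrence reflect
             (hExt-near 0 0 ℕ.z≤n ≡.refl) (λ k k<2m → hExt-near 0 (suc k) k<2m ≡.refl) p ⟩
      det {m} _ * det {m} _
        ≈⟨ *-cong (det-cong {m} (λ i j → +-cong (P i j) (Q i j))) (det-cong {m} (λ i j → +-cong (P i j) (-‿cong (Q i j)))) ⟩
      det (sums p) * det (differences p) ∎
      where
      monic : charPoly W (suc (m ℕ.+ m)) ≈ 1#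
      monic = trans (reflexive (≡.cong (charPoly W ∘ suc) (≡.sym m*2≡m+m))) (charPoly-monic W)
      recurrence : ∀ r → hExt W r ≈ sumFin {suc (m ℕ.+ m)} (λ k → charPoly W (suc (toℕ k)) * hExt W (+ suc (toℕ k) ℤ.+ r))
      recurrence = ≡.subst
        (λ M → ∀ r → hExt W r ≈ sumFin {suc M} (λ k → charPoly W (suc (toℕ k)) * hExt W (+ suc (toℕ k) ℤ.+ r)))
        m*2≡m+m (hExt-recurrence W inv)
      reflect : ∀ r → hExt W (ℤ.- (+ suc (m ℕ.+ m)) ℤ.- r) ≈ hExt W r
      reflect = ≡.subst (λ M → ∀ r → hExt W (ℤ.- (+ suc M) ℤ.- r) ≈ hExt W r) m*2≡m+m (hExt-reflect W)
      2m+1≡N : 2 ℕ.* m ℕ.+ 1 ≡ suc (m ℕ.+ m)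
      2m+1≡N = ≡.trans (ℕ.+-comm (2 ℕ.* m) 1) (≡.cong (λ k → suc (m ℕ.+ k)) (ℕ.+-identityʳ m))
      e₁ : ∀ d i j → d ℤ.- i ℤ.+ j ≡ d ℤ.+ j ℤ.- i
      e₁ = solve-∀
      e₂ : ∀ d i j → d ℤ.- i ℤ.- j ℤ.- + 1 ≡ d ℤ.- (+ 1 ℤ.+ (i ℤ.+ j))
      e₂ = solve-∀
      jt : ∀ i j → i ℕ.≤ m ℕ.+ m → hExt W (doubled m p i ℤ.- + i ℤ.+ + j) ≈ H (doubled m p i ℤ.- + i ℤ.+ + j)
      jt i j i≤2m with doubled-nonneg m p p≤p₀ i
      ... | d , λᵢ≡d = hExt-near (d ℕ.+ j) i i≤2m (≡.trans (≡.cong (λ x → x ℤ.- + i ℤ.+ + j) λᵢ≡d) (e₁ (+ d) (+ i) (+ j)))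
      P : ∀ (i j : Fin m) → hExt W (+ p (toℕ i) ℤ.- + toℕ i ℤ.+ + toℕ j) ≈ H (+ p (toℕ i) ℤ.- + toℕ i ℤ.+ + toℕ j)
      P i j = hExt-near (p (toℕ i) ℕ.+ toℕ j) (toℕ i) (ℕ.≤-trans (ℕ.<⇒≤ (Fin.toℕ<n i)) (ℕ.m≤m+n m m)) (e₁ (+ p (toℕ i)) (+ toℕ i) (+ toℕ j))
      Q : ∀ (i j : Fin m) → hExt W (+ p (toℕ i) ℤ.- + toℕ i ℤ.- + toℕ j ℤ.- + 1) ≈ H (+ p (toℕ i) ℤ.- + toℕ i ℤ.- + toℕ j ℤ.- + 1)
      Q i j = hExt-near (p (toℕ i)) (suc (toℕ i ℕ.+ toℕ j)) (ℕ.+-mono-<-≤ (Fin.toℕ<n i) (ℕ.<⇒≤ (Fin.toℕ<n j))) (e₂ (+ p (toℕ i)) (+ toℕ i) (+ toℕ j))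

    sp≈det : ¬ (1# + 1# ≈ 0#) → 1 ℕ.≤ m → ∀ (p : ℕ → ℕ) →
      sp {m} (λ i → + p (toℕ i)) W
        ≈ det (differences p)
    sp≈det 2≉0 1≤m p = begin
      sp {m} (λ i → + p (toℕ i)) W
        ≈⟨ *-congˡ (det-sp 1≤m (λ i → + p (toℕ i) ℤ.- + toℕ i) (withInv W)) ⟩
      (1# + 1#) ⁻¹ * ((1# + 1#) * det {m} D)
        ≈⟨ solve 3 (λ x y d → x :* (y :* d) := (y :* x) :* d) refl _ _ _ ⟩
      ((1# + 1#) * (1# + 1#) ⁻¹) * det {m} D
        ≈⟨ *-cong (inverseʳ _ 2≉0) (det-cong {m} (λ i j → +-cong
             (h-↭ (withInv-balanced W) (+ p (toℕ i) ℤ.- + toℕ i ℤ.+ + toℕ j))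
             (-‿cong (h-↭ (withInv-balanced W) (+ p (toℕ i) ℤ.- + toℕ i ℤ.- + toℕ j ℤ.- + 1))))) ⟩
      1# * det (differences p)
        ≈⟨ *-identityˡ _ ⟩
      det (differences p) ∎
      where
      D : Matrix m
      D i j = h (+ p (toℕ i) ℤ.- + toℕ i ℤ.+ + toℕ j) (1# ∷ withInv W)
            - h (+ p (toℕ i) ℤ.- + toℕ i ℤ.- + toℕ j ℤ.- + 1) (1# ∷ withInv W)

    oe≈det : ∀ (p : ℕ → ℕ) → p m ≡ 0 →
      oe {m ℕ.+ 1} (λ i → + p (toℕ i)) (W ++ 1# ∷ [])
        ≈ det (sums p)
    oe≈det p pₘ≡0 = begin
      oe {m ℕ.+ 1} (λ i → + p (toℕ i)) (W ++ 1# ∷ [])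
        ≈⟨ det-cong {m ℕ.+ 1} (λ i j → +-cong
             (h-↭ (withInv-∷ʳ1 W) (+ p (toℕ i) ℤ.- + toℕ i ℤ.+ + toℕ j))
             (-‿cong (h-↭ (withInv-∷ʳ1 W) (+ p (toℕ i) ℤ.- + toℕ i ℤ.- + toℕ j ℤ.- + 2)))) ⟩
      det {m ℕ.+ 1} (λ i j → k (toℕ i) (toℕ j))
        ≡⟨ det-resize (ℕ.+-comm m 1) k ⟩
      det {suc m} (λ i j → k (toℕ i) (toℕ j))
        ≈⟨ det-oe {m} (λ i → + p (toℕ i) ℤ.- + toℕ i) (balanced W) ⟩
      det {suc m} (λ i j → g (toℕ i) (toℕ j))
        ≡⟨ det-resize (ℕ.+-comm m 1) g ⟨
      det {m ℕ.+ 1} (λ i j → g (toℕ i) (toℕ j))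
        ≈⟨ det-lastRow m g lastRow ⟩
      det {m} (λ i j → g (toℕ i) (toℕ j)) * g m m
        ≈⟨ trans (*-congˡ corner) (*-identityʳ _) ⟩
      det {m} (λ i j → g (toℕ i) (toℕ j)) ∎
      where
      k g : ℕ → ℕ → Carrier
      k i j = h (+ p i ℤ.- + i ℤ.+ + j) (1# ∷ balanced W) - h (+ p i ℤ.- + i ℤ.- + j ℤ.- + 2) (1# ∷ balanced W)
      g i j = H (+ p i ℤ.- + i ℤ.+ + j) + H (+ p i ℤ.- + i ℤ.- + j ℤ.- + 1)
      e₁ : ∀ m j → + 0 ℤ.- m ℤ.- j ℤ.- + 1 ≡ ℤ.- (+ 1 ℤ.+ (m ℤ.+ j))
      e₁ = solve-∀
      e₂ : ∀ j o → + 0 ℤ.- (+ 1 ℤ.+ j ℤ.+ o) ℤ.+ j ≡ ℤ.- (+ 1 ℤ.+ o)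
      e₂ = solve-∀
      e₃ : ∀ m → + 0 ℤ.- m ℤ.+ m ≡ + 0
      e₃ = solve-∀
      second : ∀ j → H (+ p m ℤ.- + m ℤ.- + j ℤ.- + 1) ≡ 0#
      second j = ≡.cong H (≡.trans (≡.cong (λ x → + x ℤ.- + m ℤ.- + j ℤ.- + 1) pₘ≡0) (e₁ (+ m) (+ j)))
      lastRow : ∀ j → j ℕ.< m → g m j ≈ 0#
      lastRow j j<m with ℕ.m≤n⇒∃[o]m+o≡n j<m
      ... | o , j+1+o≡m = trans (+-cong
        (reflexive (≡.cong H (≡.trans (≡.cong₂ (λ x y → + x ℤ.- + y ℤ.+ + j) pₘ≡0 (≡.sym j+1+o≡m)) (e₂ (+ j) (+ o)))))
        (reflexive (second j))) (+-identityʳ _)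
      -- The first term is `H 0`; the second sits at `-N`, where `H`, unlike `hExt`, is 0.
      corner : g m m ≈ 1#
      corner = trans (+-cong (reflexive (≡.cong H (≡.trans (≡.cong (λ x → + x ℤ.- + m ℤ.+ + m) pₘ≡0) (e₃ (+ m)))))
        (reflexive (second m))) (+-identityʳ _)

  schur-factorization : ¬ (1# + 1# ≈ 0#) → ∀ {m} → 1 ℕ.≤ m → ∀ W → length W ≡ m → All Invertible W →
    ∀ (μ : Vec ℕ m) → IsPartition μ →
    schur (pmPart μ) (balanced W) ≈ sp (asℤ μ m) W * oe (asℤ μ (m ℕ.+ 1)) (W ++ 1# ∷ [])
  schur-factorization 2≉0 1≤m W ≡.refl inv μ μ↘ = begin
    schur (pmPart μ) (balanced W)
      ≈⟨ h-factorization W inv (part μ) (part-≤-first μ μ↘) ⟩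
    det (sums W (part μ)) * det (differences W (part μ))
      ≈⟨ *-cong (oe≈det W (part μ) (part-beyond μ ℕ.≤-refl)) (sp≈det W 2≉0 1≤m (part μ)) ⟨
    oe (asℤ μ (length W ℕ.+ 1)) (W ++ 1# ∷ []) * sp (asℤ μ (length W)) W
      ≈⟨ *-comm _ _ ⟩
    sp (asℤ μ (length W)) W * oe (asℤ μ (length W ℕ.+ 1)) (W ++ 1# ∷ []) ∎

  toList-invertible : ∀ {n} (x : Vec Carrier n) → (∀ i → ¬ (lookup x i ≈ 0#)) → All Invertible (toList x)
  toList-invertible []      x≉0 = []
  toList-invertible (y ∷ x) x≉0 = inverseʳ y (x≉0 zero) ∷ toList-invertible x (x≉0 ∘ suc)

theorem4p4 : ∀ {c ℓ} (F : Field c ℓ) →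
    let open Field F in let open FieldDefs F in
    ¬ (1# + 1# ≈ 0#) →
    (t : ℕ) → 2 ℕ.≤ t → (ω : Carrier) → IsPrimitiveRoot t ω →
    (n : ℕ) → 1 ℕ.≤ n → (x : Vec Carrier n) → (∀ i → ¬ (lookup x i ≈ 0#)) →
    (μ : Vec ℕ (t ℕ.* n)) → IsPartition μ →
    schur (pmPart μ) (rotations t ω (withInv (toList x)) ++ 1# ∷ [])
    ≈ sp (asℤ μ (t ℕ.* n)) (rotations t ω (toList x))
    * oe (asℤ μ (t ℕ.* n ℕ.+ 1)) (rotations t ω (toList x) ++ 1# ∷ [])
theorem4p4 F 2≉0 t 2≤t ω (ωᵗ≈1 , _) n 1≤n x x≉0 μ μ↘ = trans
  (det-cong (λ i j → h-↭ (rotations-withInv t ω ωᵗ≈1 (toList x) x-inv) (pmPart μ i ℤ.- + toℕ i ℤ.+ + toℕ j)))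
  -- The bound `1 ≤ t * n` makes the matrix of `sp` nonempty, so that its first column can absorb
  -- the factor 1/2.
  (schur-factorization 2≉0 (ℕ.*-mono-≤ (ℕ.<⇒≤ 2≤t) 1≤n) (rotations t ω (toList x)) length-W
    (rotations-invertible t ω ωᵗ≈1 (toList x) x-inv) μ μ↘)
  where
  open Field F using (trans)
  open FieldDefs F
  open Determinants F using (det-cong)
  open Alphabets F
  open Characters F
  x-inv = toList-invertible x x≉0
  length-W = ≡.trans (length-rotations t ω ωᵗ≈1 (toList x)) (≡.cong (t ℕ.*_) (Vec.length-toList x))
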